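{- Let $\theta=\langle k;\bar r\rangle$ and $\delta=\langle l;\bar s\rangle$ be congruences of $\mathbf{L}_n$ ($n\ge1$), each with more than one class, with $k\le l$, such that $\theta\vee\delta\ne\{0,\dots,n\}^2$ and $\mathrm{ext}(\theta)\cap\mathrm{ext}(\delta)=\{0,n\}$. Then one of the following holds: (1) $\mathsf{f}_\delta=1$ (i.e., $\delta$ is the identity); (2) $\mathsf{f}_\delta=2$ and $\theta$ is mirrored; (3) $\mathsf{f}_\delta\ge3$ and one of: (a) neither has rests; (b) $\theta$ is even with rests on top and $\delta$ is odd without rests, or $\delta$ is even with rests on top and $\theta$ is odd without rests; (c) both are odd with rests on top; (d) both have the same parity and both have rests on the bottom; (e) $\theta$ is even with rests on the bottom and $\delta$ is odd with rests everywhere, or $\delta$ is even with rests on the bottom and $\theta$ is odd with rests everywhere; (f) both have rests everywhere.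
   Context: For an integer $n\ge 0$, the line $\mathbf{L}_n$ is the frame $\langle\{0,\dots,n\},R\rangle$ where $x\mathrel{R}y$ iff $|x-y|\le 1$. A congruence of $\mathbf{L}_n$ is an equivalence relation $\theta$ on $\{0,\dots,n\}$ such that whenever $x'\mathrel{\theta}x$ and $x\mathrel{R}y$ there is $y'$ with $x'\mathrel{R}y'$ and $y'\mathrel{\theta}y$; join = generated equivalence relation. For $k\ge1$ and a strictly increasing sequence $\bar r=\langle r_1,\dots,r_m\rangle$ of non-negative integers, $\Delta_{\bar r}(x)=|\{i: r_i<x\}|$ and $x\,\langle k;\bar r\rangle\,y$ iff $x-\Delta_{\bar r}(x)\equiv \pm(y-\Delta_{\bar r}(y))\pmod{2k}$. Every congruence with more than one class is $\langle k;\bar r\rangle$ with $k$ = number of classes minus one and $\bar r$ the list of $r$ with $r\mathrel{\theta}r+1$ (its rests); its frequency is $\mathsf{f}_\theta=(n-m)/k$, and it is even/odd according to $\mathsf{f}_\theta$. The quotient by $\theta$ is a line; $e$ is an extreme if $e/\theta$ is an endpoint, $\mathrm{ext}(\theta)$ the set of extremes. $\langle k;\bar r\rangle$ is mirrored if $r\in\bar r\iff n-r-1\in\bar r$. It has rests on top if $m\ge1$ and $r_i=(2k+1)i-k-1$ for all $i$; rests on the bottom if $m\ge1$ and $r_i=(2k+1)i-1$ for all $i$; rests everywhere if $m\ge1$ and $r_i=(k+1)i-1$ for all $i$. -}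

module Defs where

open import Data.Nat using (ℕ; zero; suc; _+_; _*_; _∸_; _≤_; _<_; ∣_-_∣)
open import Data.Nat.DivMod using (_/_)
open import Data.Nat.Divisibility using (_∣_)
open import Data.List using (List; []; map; length; filter; upTo)
open import Data.List.Relation.Unary.All using (All; all?)
open import Data.List.Membership.Propositional using (_∈_)
open import Data.Product using (Σ; _×_; ∃)
open import Data.Sum using (_⊎_)
open import Relation.Nullary using (¬_; ¬?)
open import Relation.Binary using (Rel; Decidable)
open import Relation.Binary.PropositionalEquality using (_≡_)
open import Relation.Binary.Construct.Closure.ReflexiveTransitive using (Star)

-- The accessibility relation of the line L_n (on ℕ; only points ≤ n matter).
_R_ : ℕ → ℕ → Set
x R y = ∣ x - y ∣ ≤ 1

-- A (decidable) congruence of L_n, given as a relation on ℕ whose behaviour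
-- is only constrained (and only ever used) on {0,…,n}.
record Congruence (n : ℕ) : Set₁ where
  field
    _≈_    : ℕ → ℕ → Set
    dec    : Decidable _≈_
    refl   : ∀ {x} → x ≤ n → x ≈ x
    sym    : ∀ {x y} → x ≤ n → y ≤ n → x ≈ y → y ≈ x
    trans  : ∀ {x y z} → x ≤ n → y ≤ n → z ≤ n → x ≈ y → y ≈ z → x ≈ z
    zigzag : ∀ {x x′ y} → x ≤ n → x′ ≤ n → y ≤ n →
             x′ ≈ x → x R y → Σ ℕ λ y′ → y′ ≤ n × x′ R y′ × y′ ≈ y

module _ {n : ℕ} (θ : Congruence n) where
  open Congruence θ

  IsLeast : ℕ → Set
  IsLeast x = All (λ y → ¬ (y ≈ x)) (upTo x)

  numClasses : ℕ
  numClasses = length (filter (λ x → all? (λ y → ¬? (dec y x)) (upTo x)) (upTo (suc n)))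

  kOf : ℕ
  kOf = numClasses ∸ 1

  rests : List ℕ
  rests = filter (λ r → dec r (suc r)) (upTo n)

  mOf : ℕ
  mOf = length rests

-- division returning 0 for divisor 0 (only used with divisor ≥ 1)
div′ : ℕ → ℕ → ℕ
div′ a zero    = zero
div′ a (suc k) = a / suc k

module _ {n : ℕ} (θ : Congruence n) where
  open Congruence θ

  freq : ℕ
  freq = div′ (n ∸ mOf θ) (kOf θ)

  IsEven : Set
  IsEven = 2 ∣ freq

  IsOdd : Set
  IsOdd = ¬ (2 ∣ freq)

  QR : ℕ → ℕ → Set
  QR x y = Σ ℕ λ x′ → Σ ℕ λ y′ → x′ ≤ n × y′ ≤ n × x′ ≈ x × y′ ≈ y × x′ R y′

  -- e is an extreme: e/θ is an endpoint of the quotient line, i.e. e/θ has at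
  -- most one R-neighbour class different from itself.
  Extreme : ℕ → Set
  Extreme e = e ≤ n × (∀ y z → y ≤ n → z ≤ n → QR e y → QR e z →
                         y ≈ e ⊎ z ≈ e ⊎ y ≈ z)

  Mirrored : Set
  Mirrored = ∀ r → r < n → (r ∈ rests θ → (n ∸ r ∸ 1) ∈ rests θ)
                          × ((n ∸ r ∸ 1) ∈ rests θ → r ∈ rests θ)

  NoRests : Set
  NoRests = rests θ ≡ []

  RestsBy : (ℕ → ℕ) → Set
  RestsBy g = 1 ≤ mOf θ × rests θ ≡ map (λ i → g (suc i)) (upTo (mOf θ))

  RestsOnTop : Set
  RestsOnTop = RestsBy (λ i → (2 * kOf θ + 1) * i ∸ kOf θ ∸ 1)

  RestsOnBottom : Set
  RestsOnBottom = RestsBy (λ i → (2 * kOf θ + 1) * i ∸ 1)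

  RestsEverywhere : Set
  RestsEverywhere = RestsBy (λ i → (kOf θ + 1) * i ∸ 1)

module _ {n : ℕ} (θ δ : Congruence n) where
  Union : ℕ → ℕ → Set
  Union x y = x ≤ n × y ≤ n × (Congruence._≈_ θ x y ⊎ Congruence._≈_ δ x y)

  Join : ℕ → ℕ → Set
  Join = Star Union

  JoinIsFull : Set
  JoinIsFull = ∀ x y → x ≤ n → y ≤ n → Join x y

module Submission where

-- Call r an edge if r and r + 1 are related in the join of θ and δ.  As the join is not
-- full, no two edges are adjacent and neither end of the line carries one.  Measure the
-- height of a point by the number of non-edges before it.  A congruence θ folds the line
-- into f = freq θ segments, each the mirror image of the previous one; hence its i-th
-- turning point has height i h for a fixed h, and the set T of heights of edges is
-- symmetric near each turning point.  Likewise for δ, with g and h′, and f h = g h′.  A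
-- common factor of f and g would give a common turning point, so f and g are coprime,
-- h = c g and h′ = c f.  If f, g ≥ 3, whether c x ∈ T depends only on the parity of x: one
-- moves modulo ± 2 g off the multiples of g and modulo ± 2 f off the multiples of f, and
-- the Chinese remainder theorem leads to x = 1 or x = 2.  The rests of θ are the edges at
-- heights c g i and those of δ the edges at heights c f j, so only four patterns of rests
-- remain.  If g = 2, the set of edges is symmetric under reversal of the line, hence so is
-- the set of rests of θ.
-- Edges are decidable only up to double negation, which is harmless because the
-- conclusion is decidable.

open import Defs
open import Data.Nat
open import Data.Nat.Properties
open import Data.Nat.DivMod
open import Data.Nat.Divisibility
open import Data.Nat.Coprimality using (Coprime; coprime-divisor; coprime-Bézout)
import Data.Nat.Coprimality as Coprimality
open import Data.Nat.GCD using (module Bézout)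
open import Data.Nat.Tactic.RingSolver using (solve-∀)
open import Data.List using ([]; _∷_; _++_; map; length; filter; upTo; applyUpTo)
open import Data.List.Properties using (upTo-∷ʳ; length-++; filter-++; map-upTo; map-cong; ≡-dec)
open import Data.List.Relation.Unary.All using (all?; lookup)
open import Data.List.Relation.Unary.All.Properties using (applyUpTo⁻; applyUpTo⁺₁)
open import Data.List.Relation.Unary.Any using (here; there)
open import Data.List.Relation.Unary.AllPairs using (AllPairs; []; _∷_)
import Data.List.Relation.Unary.AllPairs.Properties as AllPairs
open import Data.List.Membership.Propositional using (_∈_)
open import Data.List.Membership.Propositional.Properties using (∈-filter⁺; ∈-filter⁻; ∈-upTo⁺; ∈-upTo⁻)
open import Data.List.Membership.DecPropositional _≟_ using (_∈?_)
open import Data.Product using (∃; ∃₂; _×_; _,_; proj₁; proj₂)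
open import Data.Sum using (_⊎_; inj₁; inj₂)
open import Function.Bundles using (_⇔_; mk⇔; module Equivalence)
open import Function.Properties.Equivalence using () renaming (refl to ⇔-refl; sym to ⇔-sym; trans to ⇔-trans)
open import Relation.Nullary using (¬_; ¬?; Dec; yes; no; contradiction)
open import Relation.Nullary.Decidable using (_×-dec_; _⊎-dec_; map′; decidable-stable; ¬¬-excluded-middle)
open import Relation.Unary using (Decidable)
open import Relation.Binary.Construct.Closure.ReflexiveTransitive using (ε; _◅_; _◅◅_; reverse)
open import Relation.Binary.Definitions using (tri<; tri≈; tri>)
open import Relation.Binary.PropositionalEquality
open Equivalence using (to; from)

-- Sequences with two families of mirrors

-- Congruence up to sign, with both sides moved so that no subtraction occurs.
data _≡±_mod_ (x y M : ℕ) : Set where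
  same     : ∀ i j → x + i * M ≡ y + j * M → x ≡± y mod M
  opposite : ∀ i j → x + y + i * M ≡ j * M → x ≡± y mod M

≡±-sym : ∀ {x y M} → x ≡± y mod M → y ≡± x mod M
≡±-sym (same i j eq) = same j i (sym eq)
≡±-sym {x} {y} {M} (opposite i j eq) = opposite i j (trans (cong (_+ i * M) (+-comm y x)) eq)

≡±-trans : ∀ {x y z M} → x ≡± y mod M → y ≡± z mod M → x ≡± z mod M
≡±-trans {x} {y} {z} {M} (same i j p) (same k l q) = same (i + k) (j + l) (begin
  x + (i + k) * M     ≡⟨ shift x i k M ⟩
  (x + i * M) + k * M ≡⟨ cong (_+ k * M) p ⟩
  (y + j * M) + k * M ≡⟨ swap y j k M ⟩
  (y + k * M) + j * M ≡⟨ cong (_+ j * M) q ⟩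
  (z + l * M) + j * M ≡⟨ swap′ z l j M ⟩
  z + (j + l) * M     ∎)
  where
  open ≡-Reasoning
  shift : ∀ x i k M → x + (i + k) * M ≡ (x + i * M) + k * M
  shift = solve-∀
  swap : ∀ y j k M → (y + j * M) + k * M ≡ (y + k * M) + j * M
  swap = solve-∀
  swap′ : ∀ z l j M → (z + l * M) + j * M ≡ z + (j + l) * M
  swap′ = solve-∀
≡±-trans {x} {y} {z} {M} (same i j p) (opposite k l q) = opposite (i + k) (j + l) (begin
  x + z + (i + k) * M     ≡⟨ e₁ x z i k M ⟩
  (x + i * M) + (z + k * M) ≡⟨ cong (_+ (z + k * M)) p ⟩
  (y + j * M) + (z + k * M) ≡⟨ e₂ y z j k M ⟩
  (y + z + k * M) + j * M ≡⟨ cong (_+ j * M) q ⟩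
  l * M + j * M           ≡⟨ e₃ l j M ⟩
  (j + l) * M             ∎)
  where
  open ≡-Reasoning
  e₁ : ∀ x z i k M → x + z + (i + k) * M ≡ (x + i * M) + (z + k * M)
  e₁ = solve-∀
  e₂ : ∀ y z j k M → (y + j * M) + (z + k * M) ≡ (y + z + k * M) + j * M
  e₂ = solve-∀
  e₃ : ∀ l j M → l * M + j * M ≡ (j + l) * M
  e₃ = solve-∀
≡±-trans {x} {y} {z} {M} (opposite i j p) (opposite k l q) = same (l + i) (k + j) (begin
  x + (l + i) * M             ≡⟨ e₁ x l i M ⟩
  l * M + (x + i * M)         ≡⟨ cong (_+ (x + i * M)) (sym q) ⟩
  y + z + k * M + (x + i * M) ≡⟨ e₂ x y z i k M ⟩
  x + y + i * M + (z + k * M) ≡⟨ cong (_+ (z + k * M)) p ⟩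
  j * M + (z + k * M)         ≡⟨ e₃ z j k M ⟩
  z + (k + j) * M             ∎)
  where
  open ≡-Reasoning
  e₁ : ∀ x l i M → x + (l + i) * M ≡ l * M + (x + i * M)
  e₁ = solve-∀
  e₂ : ∀ x y z i k M → y + z + k * M + (x + i * M) ≡ x + y + i * M + (z + k * M)
  e₂ = solve-∀
  e₃ : ∀ z j k M → j * M + (z + k * M) ≡ z + (k + j) * M
  e₃ = solve-∀
≡±-trans p@(opposite _ _ _) q@(same _ _ _) = ≡±-sym (≡±-trans (≡±-sym q) (≡±-sym p))

≡±-divisor : ∀ {x y M N} → M ∣ N → x ≡± y mod N → x ≡± y mod M
≡±-divisor {x} {y} {M} (divides c refl) (same i j eq) = same (i * c) (j * c)
  (trans (cong (x +_) (*-assoc i c M)) (trans eq (cong (y +_) (sym (*-assoc j c M)))))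
≡±-divisor {x} {y} {M} (divides c refl) (opposite i j eq) = opposite (i * c) (j * c)
  (trans (cong (x + y +_) (*-assoc i c M)) (trans eq (sym (*-assoc j c M))))

∣-resp-≡± : ∀ {x y M d} → d ∣ M → x ≡± y mod M → d ∣ x → d ∣ y
∣-resp-≡± {x} {y} {M} {d} d∣M (same i j eq) d∣x =
  ∣m+n∣m⇒∣n (subst (d ∣_) (trans eq (+-comm y _)) (∣m∣n⇒∣m+n d∣x (∣n⇒∣m*n i d∣M))) (∣n⇒∣m*n j d∣M)
∣-resp-≡± {x} {y} {M} {d} d∣M (opposite i j eq) d∣x =
  ∣m+n∣m⇒∣n (∣m+n∣m⇒∣n (subst (d ∣_) (sym (trans (+-comm (i * M) (x + y)) eq)) (∣n⇒∣m*n j d∣M)) (∣n⇒∣m*n i d∣M)) d∣x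

-- Equal residues mean equality, as both numbers lie below `2 * g`. In the opposite case
-- `p + q < 2 * g` is a multiple of `2 * g`, hence 0, against `0 < p`.
≡±-unique : ∀ {p q g} → 0 < p → p < g → q < g → p ≡± q mod (2 * g) → p ≡ q
≡±-unique {p} {q} {g} 0<p p<g q<g = λ where
    (same i j eq) → begin-equality
      p                 ≡⟨ m<n⇒m%n≡m (<-trans p<g g<2g) ⟨
      p % (2 * g)       ≡⟨ [m+kn]%n≡m%n p i (2 * g) ⟨
      (p + i * (2 * g)) % (2 * g) ≡⟨ cong (_% (2 * g)) eq ⟩
      (q + j * (2 * g)) % (2 * g) ≡⟨ [m+kn]%n≡m%n q j (2 * g) ⟩
      q % (2 * g)       ≡⟨ m<n⇒m%n≡m (<-trans q<g g<2g) ⟩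
      q                 ∎
    (opposite i j eq) → contradiction 0<p (subst (λ z → ¬ (0 < z)) (sym (m+n≡0⇒m≡0 p {q} (begin-equality
      p + q                       ≡⟨ m<n⇒m%n≡m p+q<2g ⟨
      (p + q) % (2 * g)           ≡⟨ [m+kn]%n≡m%n (p + q) i (2 * g) ⟨
      (p + q + i * (2 * g)) % (2 * g) ≡⟨ cong (_% (2 * g)) eq ⟩
      (j * (2 * g)) % (2 * g)     ≡⟨ m*n%n≡0 j (2 * g) ⟩
      0                           ∎))) (<-irrefl refl))
  where
  open ≤-Reasoning
  instance
    g≢0 : NonZero g
    g≢0 = >-nonZero (≤-<-trans z≤n p<g)
    2g≢0 : NonZero (2 * g)
    2g≢0 = m*n≢0 2 g
  g<2g : g < 2 * g
  g<2g = m<m+n g {g + 0} (<-≤-trans (≤-<-trans z≤n p<g) (m≤m+n g 0))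
  p+q<2g : p + q < 2 * g
  p+q<2g = subst (p + q <_) (cong (g +_) (sym (+-identityʳ g))) (+-mono-< p<g q<g)

-- T is symmetric, within distance g, about each of the points g, 2 g, …, (f - 1) g.
Mirroring : (ℕ → Set) → ℕ → ℕ → Set
Mirroring T f g = ∀ i a a′ → a + a′ ≡ g → 0 < a → 0 < a′ → suc i < f → T (i * g + a) ⇔ T (suc i * g + a′)

module _ (T : ℕ → Set) {f g : ℕ} (mirror : Mirroring T f g) where

  private
    Representative : ℕ → Set
    Representative x = ∃ λ p → 0 < p × p < g × x ≡± p mod (2 * g) × (T x ⇔ T p)

  -- Reflections carry the point down to the first segment, one segment at a time. Reflecting about
  -- `m * g` replaces `x` by `2 * m * g - x`, which is `x` up to sign modulo `2 * g`.
  representative : ∀ i a a′ → a + a′ ≡ g → 0 < a → 0 < a′ → i < f → Representative (i * g + a)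
  representative zero a a′ eq 0<a 0<a′ _ =
    a , 0<a , subst (a <_) eq (m<m+n a 0<a′) , same 0 0 refl , ⇔-refl
  representative (suc i) a a′ eq 0<a 0<a′ i<f =
    let p , 0<p , p<g , x≡±p , T⇔ = representative i a′ a (trans (+-comm a′ a) eq) 0<a′ 0<a (<-trans (n<1+n i) i<f)
    in p , 0<p , p<g , ≡±-trans (opposite 0 (suc i) reflected) x≡±p
       , ⇔-trans (⇔-sym (mirror i a′ a (trans (+-comm a′ a) eq) 0<a′ 0<a i<f)) T⇔
    where
    rearrange : ∀ i a a′ g → (g + i * g + a) + (i * g + a′) + 0 ≡ (a + a′) + (g + 2 * (i * g))
    rearrange = solve-∀
    collect : ∀ i g → g + (g + 2 * (i * g)) ≡ suc i * (2 * g)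
    collect = solve-∀
    reflected : (suc i * g + a) + (i * g + a′) + 0 * (2 * g) ≡ suc i * (2 * g)
    reflected = trans (rearrange i a a′ g) (trans (cong (_+ (g + 2 * (i * g))) eq) (collect i g))

  representative-of : ∀ {x} → x < f * g → ¬ g ∣ x → Representative x
  representative-of {x} x<fg g∤x = subst Representative (sym x≡)
    (representative (x / g) (x % g) (g ∸ x % g) (m+[n∸m]≡n (<⇒≤ r<g)) 0<r (m<n⇒0<n∸m r<g)
      (*-cancelʳ-< g (x / g) f (≤-<-trans (subst (x / g * g ≤_) (sym x≡) (m≤m+n _ _)) x<fg)))
    where
    instance
      g≢0 : NonZero g
      g≢0 = ≢-nonZero λ g≡0 → n≮0 (subst (x <_) (trans (cong (f *_) g≡0) (*-zeroʳ f)) x<fg)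
    r<g : x % g < g
    r<g = m%n<n x g
    x≡ : x ≡ x / g * g + x % g
    x≡ = trans (m≡m%n+[m/n]*n x g) (+-comm (x % g) _)
    0<r : 0 < x % g
    0<r = n≢0⇒n>0 λ r≡0 → g∤x (m%n≡0⇒n∣m x g r≡0)

  -- Both points fold into the first segment, where a residue up to sign has only one
  -- representative.
  mirror-invariant : ∀ {x y} → x < f * g → y < f * g → ¬ g ∣ x → x ≡± y mod (2 * g) → T x ⇔ T y
  mirror-invariant {x} {y} x< y< g∤x x≡±y =
    let g∤y = λ g∣y → g∤x (∣-resp-≡± (n∣m*n 2) (≡±-sym x≡±y) g∣y)
        p , 0<p , p<g , x≡±p , Tx = representative-of x< g∤x
        q , 0<q , q<g , y≡±q , Ty = representative-of y< g∤y
        p≡q = ≡±-unique 0<p p<g q<g (≡±-trans (≡±-sym x≡±p) (≡±-trans x≡±y y≡±q))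
    in ⇔-trans Tx (⇔-trans (subst (λ z → T p ⇔ T z) p≡q ⇔-refl) (⇔-sym Ty))

inverse-mod : ∀ {f g} → 1 < g → Coprime f g → ∃₂ λ u v → v * f ≡ 1 + u * g
inverse-mod {f} {suc (suc g)} (s≤s (s≤s _)) coprime with coprime-Bézout coprime
... | Bézout.+- v u eq = u , v , sym eq
... | Bézout.-+ v zero ()
-- Here `v * f` is -1 modulo `suc (suc g)`; multiplying `v` by `suc g`, the modulus minus one, turns
-- -1 into 1.
... | Bézout.-+ v (suc u) eq = u * suc g + g , v * suc g , +-cancelʳ-≡ (suc g) _ _ (begin
  v * suc g * f + suc g           ≡⟨ e₁ v g f ⟩
  suc g * (1 + v * f)             ≡⟨ cong (suc g *_) eq ⟩
  suc g * (suc u * suc (suc g))   ≡⟨ e₂ u g ⟩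
  1 + (u * suc g + g) * suc (suc g) + suc g ∎)
  where
  open ≡-Reasoning
  e₁ : ∀ v g f → v * suc g * f + suc g ≡ suc g * (1 + v * f)
  e₁ = solve-∀
  e₂ : ∀ u g → suc g * (suc u * suc (suc g)) ≡ 1 + (u * suc g + g) * suc (suc g) + suc g
  e₂ = solve-∀

fold-mod : ∀ M .{{_ : NonZero M}} Y → ∃ λ z → z ≤ M × Y ≡± z mod (2 * M)
fold-mod M@(suc _) Y with Y % (2 * M) | m≡m%n+[m/n]*n Y (2 * M) | m%n<n Y (2 * M)
... | r | Y≡ | r<2M with r ≤? M
...   | yes r≤M = r , r≤M , same 0 (Y / (2 * M)) (trans (+-identityʳ Y) Y≡)
...   | no r≰M = 2 * M ∸ r , 2M∸r≤M , opposite 0 (suc (Y / (2 * M))) (begin-equality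
      Y + (2 * M ∸ r) + 0                             ≡⟨ +-identityʳ _ ⟩
      Y + (2 * M ∸ r)                                 ≡⟨ cong (_+ (2 * M ∸ r)) (trans Y≡ (+-comm r _)) ⟩
      Y / (2 * M) * (2 * M) + r + (2 * M ∸ r)         ≡⟨ +-assoc (Y / (2 * M) * (2 * M)) r _ ⟩
      Y / (2 * M) * (2 * M) + (r + (2 * M ∸ r))       ≡⟨ cong (Y / (2 * M) * (2 * M) +_) (m+[n∸m]≡n (<⇒≤ r<2M)) ⟩
      Y / (2 * M) * (2 * M) + 2 * M                   ≡⟨ +-comm _ (2 * M) ⟩
      suc (Y / (2 * M)) * (2 * M)                     ∎)
  where
  open ≤-Reasoning
  2M∸r≤M : 2 * M ∸ r ≤ M
  2M∸r≤M = begin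
    2 * M ∸ r   ≤⟨ ∸-monoʳ-≤ (2 * M) (≰⇒≥ r≰M) ⟩
    2 * M ∸ M   ≡⟨ m+n∸m≡n M (M + 0) ⟩
    M + 0       ≡⟨ +-identityʳ M ⟩
    M           ∎

-- By the Chinese remainder theorem x can be moved to c in two steps: a point z of
-- the line agrees up to sign with x modulo 2 g and with c modulo 2 f.
billiard : ∀ T {f g} → Coprime f g → 1 < f → 1 < g → Mirroring T f g → Mirroring T g f →
           ∀ {x c} e → x ≡ c + 2 * e → x < f * g → ¬ g ∣ x → c < f * g → ¬ f ∣ c → T x ⇔ T c
billiard T {f} {g} coprime 1<f 1<g mirror mirror′ {x} {c} e x≡ x<fg g∤x c<fg f∤c =
  let u , v , vf≡1+ug = inverse-mod 1<g coprime
      -- By its form `Y` is `c` modulo `2 * f`; it is `x` modulo `2 * g` because `v * f ≡ 1 + u * g`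
      -- and `x` exceeds `c` by `2 * e`.
      Y = c + e * v * (2 * f)
      Y≡ = begin
        c + e * v * (2 * f)             ≡⟨ e₁ c e v f ⟩
        c + 2 * e * (v * f)             ≡⟨ cong (λ w → c + 2 * e * w) vf≡1+ug ⟩
        c + 2 * e * (1 + u * g)         ≡⟨ e₂ c e u g ⟩
        (c + 2 * e) + e * u * (2 * g)   ≡⟨ cong (_+ e * u * (2 * g)) x≡ ⟨
        x + e * u * (2 * g)             ∎
      z , z≤fg , Y≡±z = fold-mod (f * g) {{m*n≢0 f g}} Y
      x≡±z = ≡±-trans (same (e * u) 0 (trans (sym Y≡) (sym (+-identityʳ Y))))
                      (≡±-divisor (*-monoʳ-∣ 2 (n∣m*n f {g})) Y≡±z)
      c≡±z = ≡±-trans (same (e * v) 0 (sym (+-identityʳ Y)))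
                      (≡±-divisor (*-monoʳ-∣ 2 (m∣m*n {f} g)) Y≡±z)
      g∤z = λ g∣z → g∤x (∣-resp-≡± (n∣m*n 2) (≡±-sym x≡±z) g∣z)
      z<fg = ≤∧≢⇒< z≤fg λ z≡fg → g∤z (subst (g ∣_) (sym z≡fg) (n∣m*n f))
  in ⇔-trans (mirror-invariant T mirror x<fg z<fg g∤x x≡±z)
       (⇔-sym (mirror-invariant T mirror′ (swap c<fg) (swap z<fg) f∤c c≡±z))
  where
  open ≡-Reasoning
  instance
    f≢0 : NonZero f
    f≢0 = >-nonZero (<-trans z<s 1<f)
    g≢0 : NonZero g
    g≢0 = >-nonZero (<-trans z<s 1<g)
  swap : ∀ {y} → y < f * g → y < g * f
  swap {y} = subst (y <_) (*-comm f g)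
  e₁ : ∀ c e v f → c + e * v * (2 * f) ≡ c + 2 * e * (v * f)
  e₁ = solve-∀
  e₂ : ∀ c e u g → c + 2 * e * (1 + u * g) ≡ (c + 2 * e) + e * u * (2 * g)
  e₂ = solve-∀

coprime-∤ : ∀ {f g j} → Coprime f g → 0 < j → j < f → ¬ f ∣ g * j
coprime-∤ coprime 0<j j<f f∣gj = <⇒≱ j<f (∣⇒≤ {{>-nonZero 0<j}} (coprime-divisor coprime f∣gj))

-- `billiard` is used with `f` and `g` exchanged: `g * j` avoids the multiples of `f` by
-- coprimality, and `c` avoids those of `g` because `0 < c ≤ 2 < g`.
turn-parity : ∀ T {f g} → Coprime f g → 2 < f → 2 < g → Mirroring T f g → Mirroring T g f →
              ∀ {j c} e → 0 < j → j < f → 0 < c → c ≤ 2 → g * j ≡ c + 2 * e → T (g * j) ⇔ T c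
turn-parity T {f} {g} coprime 2<f 2<g mirror mirror′ {j} {c} e 0<j j<f 0<c c≤2 gj≡ =
  billiard T (Coprimality.sym coprime) (<-trans (n<1+n 1) 2<g) (<-trans (n<1+n 1) 2<f) mirror′ mirror e gj≡
    (*-monoʳ-< g {{>-nonZero (<-trans z<s 2<g)}} j<f) (coprime-∤ coprime 0<j j<f)
    (<-≤-trans c<g (m≤m*n g f {{>-nonZero (<-trans z<s 2<f)}})) λ g∣c → <⇒≱ c<g (∣⇒≤ {{>-nonZero 0<c}} g∣c)
  where
  c<g : c < g
  c<g = ≤-<-trans c≤2 2<g

-- Heights along a folded line

-- Downward closure puts `G 0` into every nonempty list, and the order makes it the head; the tail
-- is treated alike with `G` shifted by one.
sorted-progression : ∀ G {xs} → (∀ {i j} → i < j → G i < G j) → AllPairs _<_ xs →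
                     (∀ {x} → x ∈ xs → ∃ λ j → x ≡ G j) → (∀ j → G (suc j) ∈ xs → G j ∈ xs) →
                     xs ≡ applyUpTo G (length xs)
sorted-progression G mono [] _ _ = refl
sorted-progression G {x ∷ xs} mono (x<xs ∷ sorted) onto closed =
  cong₂ _∷_ x≡G0 (sorted-progression (λ j → G (suc j)) (λ i<j → mono (s<s i<j)) sorted onto′ closed′)
  where
  G0∈ : ∀ j → G j ∈ x ∷ xs → G 0 ∈ x ∷ xs
  G0∈ zero    G∈ = G∈
  G0∈ (suc j) G∈ = G0∈ j (closed j G∈)
  x≡G0 : x ≡ G 0
  x≡G0 with onto (here refl)
  ... | zero  , x≡Gj = x≡Gj
  ... | suc j , x≡Gj with G0∈ (suc j) (here (sym x≡Gj))
  ...   | here G0≡x  = sym G0≡x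
  ...   | there G0∈xs = contradiction (lookup x<xs G0∈xs) (<-asym (subst (G 0 <_) (sym x≡Gj) (mono z<s)))
  onto′ : ∀ {y} → y ∈ xs → ∃ λ j → y ≡ G (suc j)
  onto′ y∈ with onto (there y∈)
  ... | zero  , y≡G0 = contradiction (lookup x<xs y∈) (<-irrefl (trans x≡G0 (sym y≡G0)))
  ... | suc j , y≡   = j , y≡
  closed′ : ∀ j → G (suc (suc j)) ∈ xs → G (suc j) ∈ xs
  closed′ j G∈ with closed (suc j) (there G∈)
  ... | here G≡x = contradiction (mono {0} {suc j} z<s) (<-irrefl (trans (sym x≡G0) (sym G≡x)))
  ... | there G∈xs = G∈xs

gap : ∀ {A : Set} → Dec A → ℕ
gap (yes _) = 0
gap (no _)  = 1

gap-yes : ∀ {A : Set} (A? : Dec A) → A → gap A? ≡ 0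
gap-yes (yes _) _ = refl
gap-yes (no ¬a) a = contradiction a ¬a

gap-no : ∀ {A : Set} (A? : Dec A) → ¬ A → gap A? ≡ 1
gap-no (yes a) ¬a = contradiction a ¬a
gap-no (no _)  _  = refl

gap-cong : ∀ {A B : Set} (A? : Dec A) (B? : Dec B) → A ⇔ B → gap A? ≡ gap B?
gap-cong (yes a) B? A⇔B = sym (gap-yes B? (to A⇔B a))
gap-cong (no ¬a) B? A⇔B = sym (gap-no B? (λ b → ¬a (from A⇔B b)))

module _ {C : ℕ → Set} (C? : Decidable C) where

  height : ℕ → ℕ
  height zero    = 0
  height (suc r) = height r + gap (C? r)

  height-rest : ∀ {r} → C r → height (suc r) ≡ height r
  height-rest {r} c = trans (cong (height r +_) (gap-yes (C? r) c)) (+-identityʳ _)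

  height-step : ∀ {r} → ¬ C r → height (suc r) ≡ suc (height r)
  height-step {r} ¬c = trans (cong (height r +_) (gap-no (C? r) ¬c)) (+-comm _ 1)

  height-mono : ∀ {x y} → x ≤ y → height x ≤ height y
  height-mono {y = y} x≤y with m≤n⇒m<n∨m≡n x≤y
  height-mono {y = suc y} x≤y | inj₁ (s≤s x≤y′) = ≤-trans (height-mono x≤y′) (m≤m+n _ _)
  height-mono             x≤y | inj₂ refl = ≤-refl

  height-all : ∀ y → (∀ {r} → r < y → C r) → height y ≡ 0
  height-all zero    _   = refl
  height-all (suc y) all = trans (height-rest (all ≤-refl)) (height-all y (λ r<y → all (<-trans r<y ≤-refl)))

  height-none : ∀ x y → (∀ {r} → r < y → ¬ C (x + r)) → height (x + y) ≡ height x + y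
  height-none x zero    _    = trans (cong height (+-identityʳ x)) (sym (+-identityʳ _))
  height-none x (suc y) none = begin
    height (x + suc y)   ≡⟨ cong height (+-suc x y) ⟩
    height (suc (x + y)) ≡⟨ height-step (none ≤-refl) ⟩
    suc (height (x + y)) ≡⟨ cong suc (height-none x y (λ r<y → none (<-trans r<y ≤-refl))) ⟩
    suc (height x + y)   ≡⟨ +-suc _ y ⟨
    height x + suc y     ∎
    where open ≡-Reasoning

  -- Heights count what the filter drops. This turns the list lengths behind the number of classes
  -- and the frequency into heights.
  length-filter-height : ∀ N → length (filter C? (upTo N)) + height N ≡ N
  length-filter-height zero = refl
  length-filter-height (suc N) = begin
    length (filter C? (upTo (suc N))) + (height N + gap (C? N))
      ≡⟨ cong (_+ (height N + gap (C? N))) split ⟩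
    length (filter C? (upTo N)) + length (filter C? (N ∷ [])) + (height N + gap (C? N))
      ≡⟨ interchange (length (filter C? (upTo N))) _ _ _ ⟩
    length (filter C? (upTo N)) + height N + (length (filter C? (N ∷ [])) + gap (C? N))
      ≡⟨ cong₂ _+_ (length-filter-height N) last ⟩
    N + 1  ≡⟨ +-comm N 1 ⟩
    suc N ∎
    where
    open ≡-Reasoning
    split : length (filter C? (upTo (suc N))) ≡ length (filter C? (upTo N)) + length (filter C? (N ∷ []))
    split = begin
      length (filter C? (upTo (suc N)))                           ≡⟨ cong (λ xs → length (filter C? xs)) (upTo-∷ʳ N) ⟨
      length (filter C? (upTo N ++ N ∷ []))                       ≡⟨ cong length (filter-++ C? (upTo N) (N ∷ [])) ⟩
      length (filter C? (upTo N) ++ filter C? (N ∷ []))           ≡⟨ length-++ (filter C? (upTo N)) ⟩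
      length (filter C? (upTo N)) + length (filter C? (N ∷ []))   ∎
    interchange : ∀ a b c d → a + b + (c + d) ≡ a + c + (b + d)
    interchange = solve-∀
    last : length (filter C? (N ∷ [])) + gap (C? N) ≡ 1
    last with C? N
    ... | yes _ = refl
    ... | no _  = refl

-- The line cut into F + 1 segments of length κ + 1 starting at the points S i, where
-- b i ∈ {0,1} tells whether the i-th and the next segment are separated by a rest.
record Shape (n : ℕ) (_∼_ : ℕ → ℕ → Set) : Set where
  field
    κ F     : ℕ
    S b     : ℕ → ℕ
    S-zero  : S 0 ≡ 0
    S-suc   : ∀ i → S (suc i) ≡ S i + suc κ + b i
    S-end   : S F + suc κ ≡ n
    b-cases : ∀ i → i < F → (b i ≡ 0 × ¬ ((S i + suc κ) ∼ suc (S i + suc κ)))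
                          ⊎ (b i ≡ 1 × ((S i + suc κ) ∼ suc (S i + suc κ)))
    reflect : ∀ {i y z} → i < F → y + z ≡ suc κ → (S (suc i) + y) ∼ (S i + z)
    inner   : ∀ {i y} → i ≤ F → y < suc κ → ¬ ((S i + y) ∼ suc (S i + y))

  Rest : ℕ → Set
  Rest r = r ∼ suc r

  S-joined : ∀ {i} → i < F → b i ≡ 0 → S (suc i) ≡ S i + suc κ
  S-joined {i} i<F b≡0 = trans (S-suc i) (trans (cong (S i + suc κ +_) b≡0) (+-identityʳ _))

  S-separated : ∀ {i} → i < F → b i ≡ 1 → S (suc i) ≡ suc (S i + suc κ)
  S-separated {i} i<F b≡1 = trans (S-suc i) (trans (cong (S i + suc κ +_) b≡1) (+-comm _ 1))

  -- The number `r` stands for the step from `r` to `r + 1`, so that `y < suc κ` covers all steps of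
  -- a segment.
  Position : ℕ → Set
  Position r = (∃₂ λ i y → i ≤ F × y < suc κ × r ≡ S i + y)
             ⊎ (∃ λ i → i < F × b i ≡ 1 × r ≡ S i + suc κ × Rest r)

  position-in-segment : ∀ {r} i → i ≤ F → r < S i + suc κ → (r < S i → Position r) → Position r
  position-in-segment {r} i i≤F r< before with r <? S i
  ... | yes r<S = before r<S
  ... | no r≮S = inj₁ (i , r ∸ S i , i≤F
                 , +-cancelˡ-< (S i) _ _ (subst (_< S i + suc κ) (sym (m+[n∸m]≡n (≮⇒≥ r≮S))) r<)
                 , sym (m+[n∸m]≡n (≮⇒≥ r≮S)))

  position-below : ∀ {r} i → i ≤ F → r < S i → Position r
  position-below {r} zero i≤F r<S = contradiction (subst (r <_) S-zero r<S) n≮0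
  position-below {r} (suc i) i<F r<S with r <? S i + suc κ
  ... | yes r< = position-in-segment i (<⇒≤ i<F) r< (position-below i (<⇒≤ i<F))
  ... | no r≮ with b-cases i i<F
  ...   | inj₁ (b≡0 , _) = contradiction (subst (r <_) (S-joined i<F b≡0) r<S) r≮
  ...   | inj₂ (b≡1 , rest) = inj₂ (i , i<F , b≡1 , r≡ , subst Rest (sym r≡) rest)
    where
    r≡ : r ≡ S i + suc κ
    r≡ = ≤-antisym (s≤s⁻¹ (subst (r <_) (S-separated i<F b≡1) r<S)) (≮⇒≥ r≮)

  position : ∀ {r} → r < n → Position r
  position {r} r<n = position-in-segment F ≤-refl (subst (r <_) (sym S-end) r<n) (position-below F ≤-refl)

  rest-turn : ∀ {r} → r < n → Rest r → ∃ λ i → i < F × b i ≡ 1 × r ≡ S i + suc κ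
  rest-turn r<n rest with position r<n
  ... | inj₁ (i , y , i≤F , y<k , refl) = contradiction rest (inner i≤F y<k)
  ... | inj₂ (i , i<F , b≡1 , r≡ , _)   = i , i<F , b≡1 , r≡

block-unique : ∀ {i j h x} → i * h < x → x < suc i * h → j * h < x → x < suc j * h → i ≡ j
block-unique {i} {j} {h} i< <i j< <j =
  ≤-antisym (s≤s⁻¹ (*-cancelʳ-< h i (suc j) (<-trans i< <j))) (s≤s⁻¹ (*-cancelʳ-< h j (suc i) (<-trans j< <i)))

not-between : ∀ {i m h x} → i * h < x → x < suc i * h → x ≢ m * h
not-between {i} {m} {h} i< <i refl =
  <-irrefl refl (<-≤-trans (*-cancelʳ-< h i m i<) (s≤s⁻¹ (*-cancelʳ-< h m (suc i) <i)))

-- The properties of edges on which the height argument rests. The edges of the join have them, and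
-- so do the rests of a congruence itself, which serve to compute its frequency. In `C-mirror` the
-- step from `x` to `x + 1` is folded onto the step from `y + 1` to `y`.
record Coarsening (n : ℕ) (_∼_ : ℕ → ℕ → Set) (C : ℕ → Set) : Set where
  field
    C-bound  : ∀ {r} → C r → r < n
    C-rest   : ∀ {r} → r ∼ suc r → C r
    C-mirror : ∀ {x y} → suc x ∼ y → x ∼ suc y → C x ⇔ C y

module Heights {n _∼_} (shape : Shape n _∼_) {C : ℕ → Set} (C? : Decidable C) (coarse : Coarsening n _∼_ C) where
  open Shape shape
  open Coarsening coarse

  H : ℕ → ℕ
  H = height C?

  h : ℕ
  h = H (suc κ)

  -- Offsets of mirrored points add up to `suc κ`, those of mirrored steps only to `κ`: a step is
  -- named by its lower end, and reflection exchanges the ends.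
  mirror-edge : ∀ {i y z} → i < F → y + z ≡ κ → C (S (suc i) + y) ⇔ C (S i + z)
  mirror-edge {i} {y} {z} i<F eq =
    C-mirror (subst (_∼ (S i + z)) (+-suc _ y) (reflect i<F (cong suc eq)))
             (subst ((S (suc i) + y) ∼_) (+-suc _ z) (reflect i<F (trans (+-suc y z) (cong suc eq))))

  height-turn : ∀ {i} → i < F → H (S (suc i)) ≡ H (S i + suc κ)
  height-turn {i} i<F with b-cases i i<F
  ... | inj₁ (b≡0 , _)    = cong H (S-joined i<F b≡0)
  ... | inj₂ (b≡1 , rest) = trans (cong H (S-separated i<F b≡1)) (height-rest C? (C-rest rest))

  -- Induction away from the turn: raising `y` by one adds the gap of a step after the turn and
  -- removes the equal gap of its mirror image before the turn.
  height-reflect : ∀ {i} → i < F → ∀ y {z} → y + z ≡ suc κ → H (S (suc i) + y) + H (S i + z) ≡ 2 * H (S (suc i))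
  height-reflect {i} i<F zero refl =
    trans (cong₂ _+_ (cong H (+-identityʳ (S (suc i)))) (sym (height-turn i<F)))
          (cong (H (S (suc i)) +_) (sym (+-identityʳ _)))
  height-reflect {i} i<F (suc y) {z} eq = begin
    H (S (suc i) + suc y) + H (S i + z)
      ≡⟨ cong (λ x → H x + H (S i + z)) (+-suc _ y) ⟩
    H (S (suc i) + y) + gap (C? (S (suc i) + y)) + H (S i + z)
      ≡⟨ cong (λ x → H (S (suc i) + y) + x + H (S i + z)) (gap-cong _ (C? (S i + z)) (mirror-edge i<F (suc-injective eq))) ⟩
    H (S (suc i) + y) + gap (C? (S i + z)) + H (S i + z)
      ≡⟨ trans (+-assoc (H (S (suc i) + y)) _ _) (cong (H (S (suc i) + y) +_) (+-comm (gap (C? (S i + z))) _)) ⟩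
    H (S (suc i) + y) + H (suc (S i + z))
      ≡⟨ cong (λ x → H (S (suc i) + y) + H x) (+-suc _ z) ⟨
    H (S (suc i) + y) + H (S i + suc z)
      ≡⟨ height-reflect i<F y (trans (+-suc y z) eq) ⟩
    2 * H (S (suc i)) ∎
    where open ≡-Reasoning

  -- Reflecting a whole segment about the turn before it shows that each segment gains the same
  -- height as its predecessor. The two statements feed each other in the induction.
  height-S   : ∀ i → i ≤ F → H (S i) ≡ i * h
  height-end : ∀ i → i ≤ F → H (S i + suc κ) ≡ suc i * h

  height-S zero    i≤F = cong H S-zero
  height-S (suc i) i<F = trans (height-turn i<F) (height-end i (<⇒≤ i<F))

  height-end zero    i≤F = trans (cong (λ s → H (s + suc κ)) S-zero) (sym (+-identityʳ h))
  height-end (suc i) i<F = +-cancelʳ-≡ (H (S i)) _ _ (begin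
    H (S (suc i) + suc κ) + H (S i)     ≡⟨ cong (λ x → H (S (suc i) + suc κ) + H x) (+-identityʳ (S i)) ⟨
    H (S (suc i) + suc κ) + H (S i + 0) ≡⟨ height-reflect i<F (suc κ) (+-identityʳ _) ⟩
    2 * H (S (suc i))                   ≡⟨ cong (2 *_) (height-S (suc i) i<F) ⟩
    2 * (suc i * h)                     ≡⟨ e i h ⟩
    suc (suc i) * h + i * h             ≡⟨ cong (suc (suc i) * h +_) (height-S i (<⇒≤ i<F)) ⟨
    suc (suc i) * h + H (S i)           ∎)
    where
    open ≡-Reasoning
    e : ∀ i h → 2 * (suc i * h) ≡ suc (suc i) * h + i * h
    e = solve-∀

  height-total : H n ≡ suc F * h
  height-total = trans (cong H (sym S-end)) (height-end F ≤-refl)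

  module Sparse (C-sparse : ∀ {r} → C r → ¬ C (suc r)) (¬C-first : ¬ C 0) (¬C-last : ∀ {r} → suc r ≡ n → ¬ C r) where

    h>0 : 0 < h
    h>0 = <-≤-trans (subst (0 <_) (sym (height-step C? ¬C-first)) z<s) (height-mono C? (s≤s z≤n))

    -- Such an edge would have an edge next to it: its own mirror image if the next segment starts
    -- at once, and the rest in between otherwise.
    ¬C-segment-last : ∀ {i} → i ≤ F → ¬ C (S i + κ)
    ¬C-segment-last {i} i≤F c with m≤n⇒m<n∨m≡n i≤F
    ... | inj₂ refl = ¬C-last (trans (sym (+-suc _ κ)) S-end) c
    ... | inj₁ i<F with b-cases i i<F
    ...   | inj₁ (b≡0 , _) =
      C-sparse c (subst C (trans (+-identityʳ _) (trans (S-joined i<F b≡0) (+-suc _ κ))) (from (mirror-edge i<F refl) c))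
    ...   | inj₂ (_ , rest) = C-sparse c (subst C (+-suc _ κ) (C-rest rest))

    ¬C-segment-first : ∀ {i} → i ≤ F → ¬ C (S i)
    ¬C-segment-first {zero} i≤F c = ¬C-first (subst C S-zero c)
    ¬C-segment-first {suc i} i<F c =
      ¬C-segment-last (<⇒≤ i<F) (to (mirror-edge i<F refl) (subst C (sym (+-identityʳ _)) c))

    -- The first and the last step of a segment are not edges, so each of them separates an edge
    -- inside from the height of an end of the segment.
    height-inside : ∀ {i y} → i ≤ F → y < suc κ → C (S i + y) → i * h < H (S i + y) × H (S i + y) < suc i * h
    height-inside {i} {zero} i≤F y<k c = contradiction (subst C (+-identityʳ _) c) (¬C-segment-first i≤F)
    height-inside {i} {suc y} i≤F y<k c = lower , upper
      where
      open ≤-Reasoning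
      lower : i * h < H (S i + suc y)
      lower = begin-strict
        i * h           ≡⟨ height-S i i≤F ⟨
        H (S i)         <⟨ n<1+n _ ⟩
        suc (H (S i))   ≡⟨ height-step C? (¬C-segment-first i≤F) ⟨
        H (suc (S i))   ≤⟨ height-mono C? (subst (suc (S i) ≤_) (sym (+-suc _ y)) (s≤s (m≤m+n _ y))) ⟩
        H (S i + suc y) ∎
      upper : H (S i + suc y) < suc i * h
      upper = begin-strict
        H (S i + suc y)   ≤⟨ height-mono C? (+-monoʳ-≤ (S i) (s≤s⁻¹ y<k)) ⟩
        H (S i + κ)       <⟨ n<1+n _ ⟩
        suc (H (S i + κ)) ≡⟨ height-step C? (¬C-segment-last i≤F) ⟨
        H (suc (S i + κ)) ≡⟨ cong H (+-suc _ κ) ⟨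
        H (S i + suc κ)   ≡⟨ height-end i i≤F ⟩
        suc i * h         ∎

    T : ℕ → Set
    T x = ∃ λ r → C r × H r ≡ x

    rest-height : ∀ {r} → r < n → Rest r → h ∣ H r
    rest-height r<n rest with rest-turn r<n rest
    ... | i , i<F , _ , refl = divides (suc i) (height-end i (<⇒≤ i<F))

    -- An edge inside a segment lies strictly between consecutive multiples of `h`. Thus height
    -- alone singles out the rests of the congruence among all edges.
    height-rest⁻¹ : ∀ {r} → C r → h ∣ H r → Rest r
    height-rest⁻¹ c (divides m Hr≡) with position (C-bound c)
    ... | inj₁ (i , y , i≤F , y<k , refl) =
      let l , u = height-inside i≤F y<k c in contradiction Hr≡ (not-between {i} {m} l u)
    ... | inj₂ (_ , _ , _ , _ , rest) = rest

    -- The turn after segment `i` has number `i + 1`. An edge of its height must be a rest at a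
    -- turn, and distinct turns have distinct heights.
    rest-at-turn : ∀ {i} → i < F → b i ≡ 1 ⇔ T (suc i * h)
    rest-at-turn {i} i<F = mk⇔ there-is λ { (r , c , Hr≡) → back r c Hr≡ }
      where
      there-is : b i ≡ 1 → T (suc i * h)
      there-is b≡1 with b-cases i i<F
      ... | inj₁ (b≡0 , _) = contradiction (trans (sym b≡0) b≡1) λ ()
      ... | inj₂ (_ , rest) = S i + suc κ , C-rest rest , height-end i (<⇒≤ i<F)
      back : ∀ r → C r → H r ≡ suc i * h → b i ≡ 1
      back r c Hr≡ with position (C-bound c)
      ... | inj₁ (j , y , j≤F , y<k , refl) =
        let l , u = height-inside j≤F y<k c in contradiction Hr≡ (not-between {j} {suc i} l u)
      ... | inj₂ (j , j<F , b≡1 , refl , _) = subst (λ m → b m ≡ 1) j≡i b≡1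
        where
        j≡i : j ≡ i
        j≡i = suc-injective (*-cancelʳ-≡ (suc j) (suc i) h {{>-nonZero h>0}} (trans (sym (height-end j (<⇒≤ j<F))) Hr≡))

    mirrored : ∀ {i y} → i < F → C (S i + y) → y < suc κ →
               ∃ λ z → y + z ≡ κ × C (S (suc i) + z) × H (S i + y) + H (S (suc i) + z) ≡ 2 * (suc i * h)
    mirrored {i} {y} i<F c y<k = κ ∸ y , m+[n∸m]≡n (s≤s⁻¹ y<k) , from (mirror-edge i<F (m∸n+n≡m (s≤s⁻¹ y<k))) c , (begin
      -- `height-reflect` needs offsets with sum `suc κ`; as an edge is flat, the offset `y` may be
      -- raised by one.
      H (S i + y) + H (S (suc i) + (κ ∸ y))       ≡⟨ cong (_+ H (S (suc i) + (κ ∸ y))) (trans (cong H (+-suc _ y)) (height-rest C? c)) ⟨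
      H (S i + suc y) + H (S (suc i) + (κ ∸ y))   ≡⟨ +-comm (H (S i + suc y)) _ ⟩
      H (S (suc i) + (κ ∸ y)) + H (S i + suc y)   ≡⟨ height-reflect i<F (κ ∸ y) (trans (+-suc _ y) (cong suc (m∸n+n≡m (s≤s⁻¹ y<k)))) ⟩
      2 * H (S (suc i))                           ≡⟨ cong (2 *_) (height-S (suc i) i<F) ⟩
      2 * (suc i * h)                             ∎)
      where open ≡-Reasoning

    mirrored⁻¹ : ∀ {i y} → i < F → C (S (suc i) + y) → y < suc κ →
                 ∃ λ z → y + z ≡ κ × C (S i + z) × H (S (suc i) + y) + H (S i + z) ≡ 2 * (suc i * h)
    mirrored⁻¹ {i} {y} i<F c y<k = κ ∸ y , m+[n∸m]≡n (s≤s⁻¹ y<k) , to (mirror-edge i<F (m+[n∸m]≡n (s≤s⁻¹ y<k))) c , (begin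
      H (S (suc i) + y) + H (S i + (κ ∸ y))       ≡⟨ cong (_+ H (S i + (κ ∸ y))) (trans (cong H (+-suc _ y)) (height-rest C? c)) ⟨
      H (S (suc i) + suc y) + H (S i + (κ ∸ y))   ≡⟨ height-reflect i<F (suc y) (cong suc (m+[n∸m]≡n (s≤s⁻¹ y<k))) ⟩
      2 * H (S (suc i))                           ≡⟨ cong (2 *_) (height-S (suc i) i<F) ⟩
      2 * (suc i * h)                             ∎)
      where open ≡-Reasoning

    inside-block : ∀ {i a r} → 0 < a → a < h → C r → H r ≡ i * h + a →
                   ∃ λ y → i ≤ F × y < suc κ × r ≡ S i + y
    inside-block {i} {a} 0<a a<h c Hr≡ with position (C-bound c)
    ... | inj₁ (j , y , j≤F , y<k , refl) =
      let l , u = height-inside j≤F y<k c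
          j≡i = block-unique {j} {i} l u (subst (i * h <_) (sym Hr≡) i<) (subst (_< suc i * h) (sym Hr≡) <i)
      in y , subst (_≤ F) j≡i j≤F , y<k , cong (λ m → S m + y) j≡i
      where
      i< : i * h < i * h + a
      i< = m<m+n _ 0<a
      <i : i * h + a < suc i * h
      <i = subst (i * h + a <_) (+-comm (i * h) h) (+-monoʳ-< (i * h) a<h)
    ... | inj₂ (j , j<F , _ , refl , _) =
      contradiction (trans (sym Hr≡) (height-end j (<⇒≤ j<F)))
        (not-between {i} {suc j} (m<m+n _ 0<a) (subst (i * h + a <_) (+-comm (i * h) h) (+-monoʳ-< (i * h) a<h)))

    -- A height strictly between two turns determines the segment of the edge. The heights of the
    -- edge and of its image about turn `i + 1` have the sum `2 * (suc i * h)`, which fixes the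
    -- second.
    T-mirroring : Mirroring T (suc F) h
    T-mirroring i a a′ eq 0<a 0<a′ (s≤s i<F) = mk⇔ there-is back
      where
      a<h : a < h
      a<h = subst (a <_) eq (m<m+n a 0<a′)
      a′<h : a′ < h
      a′<h = subst (a′ <_) (trans (+-comm a′ a) eq) (m<m+n a′ 0<a)
      rearrange : ∀ i a a′ h → (i * h + a) + (h + i * h + a′) ≡ (a + a′) + (h + 2 * (i * h))
      rearrange = solve-∀
      collect : ∀ i h → h + (h + 2 * (i * h)) ≡ 2 * (suc i * h)
      collect = solve-∀
      total : (i * h + a) + (suc i * h + a′) ≡ 2 * (suc i * h)
      total = trans (rearrange i a a′ h) (trans (cong (_+ (h + 2 * (i * h))) eq) (collect i h))
      there-is : T (i * h + a) → T (suc i * h + a′)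
      there-is (r , c , Hr≡) with inside-block {i} 0<a a<h c Hr≡
      ... | y , i≤F , y<k , refl with mirrored i<F c y<k
      ...   | z , _ , c′ , sum≡ = S (suc i) + z , c′ , +-cancelˡ-≡ (i * h + a) _ _
              (trans (cong (_+ H (S (suc i) + z)) (sym Hr≡)) (trans sum≡ (sym total)))
      back : T (suc i * h + a′) → T (i * h + a)
      back (r , c , Hr≡) with inside-block {suc i} 0<a′ a′<h c Hr≡
      ... | y , i≤F , y<k , refl with mirrored⁻¹ i<F c y<k
      ...   | z , _ , c′ , sum≡ = S i + z , c′ , +-cancelˡ-≡ (suc i * h + a′) _ _
              (trans (cong (_+ H (S i + z)) (sym Hr≡)) (trans sum≡ (trans (sym total) (+-comm (i * h + a) _))))

    -- Reflection about the only turn is the reversal of the whole line.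
    palindrome : F ≡ 1 → ∀ {r} → C r → ∃ λ r′ → r + suc r′ ≡ n × C r′ × H r + H r′ ≡ H n
    palindrome F≡1 {r} c = go (position (C-bound c))
      where
      0<F : 0 < F
      0<F = subst (0 <_) (sym F≡1) z<s
      n≡ : S 1 + suc κ ≡ n
      n≡ = trans (cong (λ f → S f + suc κ) (sym F≡1)) S-end
      total : 2 * (1 * h) ≡ H n
      total = trans (cong (2 *_) (+-identityʳ h)) (trans (cong (λ f → suc f * h) (sym F≡1)) (sym height-total))
      e : ∀ y z s → y + suc (s + z) ≡ s + suc (y + z)
      e = solve-∀
      e′ : ∀ y z s → s + y + suc z ≡ s + suc (y + z)
      e′ = solve-∀
      go : Position r → ∃ λ r′ → r + suc r′ ≡ n × C r′ × H r + H r′ ≡ H n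
      go (inj₁ (zero , y , i≤F , y<k , refl)) =
        let z , y+z , c′ , sum≡ = mirrored 0<F c y<k
        in S 1 + z , trans (cong (λ s → s + y + suc (S 1 + z)) S-zero)
             (trans (e y z (S 1)) (trans (cong (λ x → S 1 + suc x) y+z) n≡))
           , c′ , trans sum≡ total
      go (inj₁ (suc zero , y , i≤F , y<k , refl)) =
        let z , y+z , c′ , sum≡ = mirrored⁻¹ 0<F c y<k
        in S 0 + z , trans (cong (λ s → S 1 + y + suc (s + z)) S-zero)
             (trans (e′ y z (S 1)) (trans (cong (λ x → S 1 + suc x) y+z) n≡))
           , c′ , trans sum≡ total
      go (inj₁ (suc (suc i) , y , i≤F , y<k , refl)) = contradiction (subst (suc (suc i) ≤_) F≡1 i≤F) λ { (s≤s ()) }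
      go (inj₂ (suc i , i<F , _ , refl , _)) = contradiction (subst (suc i <_) F≡1 i<F) λ { (s≤s ()) }
      -- A rest at the only turn is the middle step of the line and its own image.
      go (inj₂ (zero , i<F , b≡1 , refl , _)) =
        S 0 + suc κ
        , trans (+-suc _ _) (trans (cong (suc (S 0 + suc κ) +_) (cong (_+ suc κ) S-zero))
            (trans (cong (_+ suc κ) (sym (S-separated i<F b≡1))) n≡))
        , c , trans (cong₂ _+_ (height-end 0 z≤n) (height-end 0 z≤n))
                (trans (cong (1 * h +_) (sym (+-identityʳ (1 * h)))) total)

-- The segments of a congruence

R-suc : ∀ x → x R suc x
R-suc zero    = ≤-refl
R-suc (suc x) = R-suc x

R-pred : ∀ x → suc x R x
R-pred zero    = ≤-refl
R-pred (suc x) = R-pred x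

R-cases : ∀ x y → x R y → y ≡ x ⊎ y ≡ suc x ⊎ suc y ≡ x
R-cases zero    zero          _ = inj₁ refl
R-cases zero    (suc zero)    _ = inj₂ (inj₁ refl)
R-cases zero    (suc (suc y)) (s≤s ())
R-cases (suc zero)    zero    _ = inj₂ (inj₂ refl)
R-cases (suc (suc x)) zero    (s≤s ())
R-cases (suc x) (suc y) xRy with R-cases x y xRy
... | inj₁ y≡x         = inj₁ (cong suc y≡x)
... | inj₂ (inj₁ y≡1+x) = inj₂ (inj₁ (cong suc y≡1+x))
... | inj₂ (inj₂ 1+y≡x) = inj₂ (inj₂ (cong suc 1+y≡x))

module Classes {n} (θ : Congruence n) where
  private module θ = Congruence θ
  open θ using (_≈_; dec)

  -- A congruence is constrained only up to `n`; with the bounds inside the relation, symmetry and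
  -- transitivity hold unconditionally.
  record _∼_ (x y : ℕ) : Set where
    constructor mk∼
    field
      leftBound  : x ≤ n
      rightBound : y ≤ n
      related    : x ≈ y
  open _∼_ public

  ∼-refl : ∀ {x} → x ≤ n → x ∼ x
  ∼-refl x≤n = mk∼ x≤n x≤n (θ.refl x≤n)

  ∼-reflexive : ∀ {x y} → x ≤ n → x ≡ y → x ∼ y
  ∼-reflexive x≤n refl = ∼-refl x≤n

  ∼-sym : ∀ {x y} → x ∼ y → y ∼ x
  ∼-sym (mk∼ x≤n y≤n x≈y) = mk∼ y≤n x≤n (θ.sym x≤n y≤n x≈y)

  ∼-trans : ∀ {x y z} → x ∼ y → y ∼ z → x ∼ z
  ∼-trans (mk∼ x≤n y≤n x≈y) (mk∼ _ z≤ y≈z) = mk∼ x≤n z≤ (θ.trans x≤n y≤n z≤ x≈y y≈z)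

  _∼?_ : ∀ x y → Dec (x ∼ y)
  x ∼? y with x ≤? n | y ≤? n
  ... | no x≰n | _ = no λ x∼y → x≰n (leftBound x∼y)
  ... | yes _ | no y≰n = no λ x∼y → y≰n (rightBound x∼y)
  ... | yes x≤n | yes y≤n = map′ (mk∼ x≤n y≤n) related (dec x y)

  ∼-zigzag : ∀ {x x′ y} → x′ ∼ x → x R y → y ≤ n → ∃ λ y′ → x′ R y′ × y′ ∼ y
  ∼-zigzag (mk∼ x′≤n x≤n x′≈x) xRy y≤n =
    let y′ , y′≤n , x′Ry′ , y′≈y = θ.zigzag x≤n x′≤n y≤n x′≈x xRy in y′ , x′Ry′ , mk∼ y′≤n y≤n y′≈y

  Distinct : ℕ → ℕ → Set
  Distinct s K = ∀ {y z} → y ≤ K → z ≤ K → (s + y) ∼ (s + z) → y ≡ z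

  -- 0, …, K are representatives of the classes: K + 1, if it exists, repeats one of them.
  record Representatives (K : ℕ) : Set where
    field
      bound    : K ≤ n
      distinct : Distinct 0 K
      repeat   : K ≡ n ⊎ ∃ λ y → y ≤ K × y ∼ suc K

  distinct-below : ∀ N → N ≤ n → Distinct 0 N ⊎ ∃ Representatives
  distinct-below zero N≤n = inj₁ λ { z≤n z≤n _ → refl }
  distinct-below (suc N) N<n with distinct-below N (<⇒≤ N<n)
  ... | inj₂ found = inj₂ found
  ... | inj₁ distinct with anyUpTo? (_∼? suc N) (suc N)
  ...   | yes (y , s≤s y≤N , y∼) = inj₂ (N , record { bound = <⇒≤ N<n ; distinct = distinct ; repeat = inj₂ (y , y≤N , y∼) })
  ...   | no new = inj₁ distinct′
    where
    distinct′ : Distinct 0 (suc N)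
    distinct′ y≤ z≤ y∼z with m≤n⇒m<n∨m≡n y≤ | m≤n⇒m<n∨m≡n z≤
    ... | inj₁ (s≤s y≤N) | inj₁ (s≤s z≤N) = distinct y≤N z≤N y∼z
    ... | inj₂ refl | inj₂ refl = refl
    ... | inj₁ y<1+N | inj₂ refl = contradiction (_ , y<1+N , y∼z) new
    ... | inj₂ refl | inj₁ z<1+N = contradiction (_ , z<1+N , ∼-sym y∼z) new

  representatives : ∃ Representatives
  representatives with distinct-below n ≤-refl
  ... | inj₁ distinct = n , record { bound = ≤-refl ; distinct = distinct ; repeat = inj₁ refl }
  ... | inj₂ found    = found

  module _ {K} (reps : Representatives K) where
    open Representatives reps

    -- Zigzag moves the representative of `x` to a neighbour related to `x + 1`. It can leave the
    -- range only from `K` to `K + 1`, which `repeat` excludes or undoes.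
    exhaustive : ∀ x → x ≤ n → ∃ λ y → y ≤ K × y ∼ x
    exhaustive zero x≤n = 0 , z≤n , ∼-refl x≤n
    exhaustive (suc x) x<n with exhaustive x (<⇒≤ x<n)
    ... | y , y≤K , y∼x with ∼-zigzag y∼x (R-suc x) x<n
    ...   | y′ , yRy′ , y′∼ with y′ ≤? K
    ...     | yes y′≤K = y′ , y′≤K , y′∼
    ...     | no y′≰K with R-cases y y′ yRy′
    ...       | inj₁ refl = contradiction y≤K y′≰K
    ...       | inj₂ (inj₂ refl) = contradiction (<⇒≤ y≤K) y′≰K
    ...       | inj₂ (inj₁ refl) with repeat
    ...         | inj₁ refl = contradiction (leftBound y′∼) (<⇒≱ (≰⇒> y′≰K))
    ...         | inj₂ (w , w≤K , w∼) = w , w≤K , ∼-trans (subst (λ m → w ∼ suc m) (≤-antisym (s≤s⁻¹ (≰⇒> y′≰K)) y≤K) w∼) y′∼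

    -- The count runs over the least members of classes, and these are the numbers up to `K`.
    numClasses≡ : numClasses θ ≡ suc K
    numClasses≡ = +-cancelʳ-≡ (n ∸ K) _ _ (begin
      numClasses θ + (n ∸ K)                   ≡⟨ cong (numClasses θ +_) heights ⟨
      numClasses θ + height least? (suc n)     ≡⟨ length-filter-height least? (suc n) ⟩
      suc n                                    ≡⟨ cong suc (m+[n∸m]≡n bound) ⟨
      suc K + (n ∸ K)                          ∎)
      where
      open ≡-Reasoning
      least? : Decidable (IsLeast θ)
      least? x = all? (λ y → ¬? (dec y x)) (upTo x)
      least : ∀ {x} → x < suc K → IsLeast θ x
      least {x} (s≤s x≤K) = applyUpTo⁺₁ (λ y → y) x λ {y} y<x y≈x →
        <⇒≢ y<x (distinct (≤-trans (<⇒≤ y<x) x≤K) x≤K (mk∼ (≤-trans (<⇒≤ y<x) (≤-trans x≤K bound)) (≤-trans x≤K bound) y≈x))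
      not-least : ∀ {r} → r < n ∸ K → ¬ IsLeast θ (suc K + r)
      not-least {r} r< all with exhaustive (suc K + r)
        (subst (suc K + r ≤_) (m+[n∸m]≡n bound) (subst (_≤ K + (n ∸ K)) (+-suc K r) (+-monoʳ-≤ K r<)))
      ... | y , y≤K , y∼ = applyUpTo⁻ (λ y → y) (suc K + r) all (s≤s (≤-trans y≤K (m≤m+n K r))) (related y∼)
      heights : height least? (suc n) ≡ n ∸ K
      heights = begin
        height least? (suc n)             ≡⟨ cong (λ m → height least? (suc m)) (m+[n∸m]≡n bound) ⟨
        height least? (suc K + (n ∸ K))   ≡⟨ height-none least? (suc K) (n ∸ K) not-least ⟩
        height least? (suc K) + (n ∸ K)   ≡⟨ cong (_+ (n ∸ K)) (height-all least? (suc K) least) ⟩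
        n ∸ K                             ∎

  -- The class of e is an endpoint of the quotient line, and its neighbour is the class of e′.
  Endpoint : ℕ → ℕ → Set
  Endpoint e e′ = ∀ {x y} → x ∼ e → x R y → y ≤ n → y ∼ e ⊎ y ∼ e′

  -- By zigzag each neighbour of a member of the class is related to a neighbour of `e`, so one
  -- member decides.
  endpoint : ∀ {e e′} → (∀ {y} → e R y → y ≤ n → y ∼ e ⊎ y ∼ e′) → Endpoint e e′
  endpoint near x∼e xRy y≤n with ∼-zigzag (∼-sym x∼e) xRy y≤n
  ... | y′ , eRy′ , y′∼y with near eRy′ (leftBound y′∼y)
  ...   | inj₁ y′∼e  = inj₁ (∼-trans (∼-sym y′∼y) y′∼e)
  ...   | inj₂ y′∼e′ = inj₂ (∼-trans (∼-sym y′∼y) y′∼e′)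

  endpoint-resp : ∀ {e e′ d d′} → e ∼ d → e′ ∼ d′ → Endpoint e e′ → Endpoint d d′
  endpoint-resp e∼d e′∼d′ end x∼d xRy y≤n with end (∼-trans x∼d (∼-sym e∼d)) xRy y≤n
  ... | inj₁ y∼e  = inj₁ (∼-trans y∼e e∼d)
  ... | inj₂ y∼e′ = inj₂ (∼-trans y∼e′ e′∼d′)

  endpoint-extreme : ∀ {e e′} → e ≤ n → Endpoint e e′ → Extreme θ e
  endpoint-extreme {e} {e′} e≤n end = e≤n , λ y z y≤n z≤
    (x₁ , y₁ , x₁≤n , y₁≤n , x₁≈e , y₁≈y , x₁Ry₁) (x₂ , z₁ , x₂≤n , z₁≤n , x₂≈e , z₁≈z , x₂Rz₁) →
      agree (mk∼ y₁≤n y≤n y₁≈y) (end (mk∼ x₁≤n e≤n x₁≈e) x₁Ry₁ y₁≤n)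
            (mk∼ z₁≤n z≤ z₁≈z) (end (mk∼ x₂≤n e≤n x₂≈e) x₂Rz₁ z₁≤n)
    where
    agree : ∀ {y y₁ z z₁} → y₁ ∼ y → y₁ ∼ e ⊎ y₁ ∼ e′ → z₁ ∼ z → z₁ ∼ e ⊎ z₁ ∼ e′ → y ≈ e ⊎ z ≈ e ⊎ y ≈ z
    agree y₁∼y (inj₁ y₁∼e) _ _ = inj₁ (related (∼-trans (∼-sym y₁∼y) y₁∼e))
    agree y₁∼y (inj₂ _) z₁∼z (inj₁ z₁∼e) = inj₂ (inj₁ (related (∼-trans (∼-sym z₁∼z) z₁∼e)))
    agree y₁∼y (inj₂ y₁∼e′) z₁∼z (inj₂ z₁∼e′) =
      inj₂ (inj₂ (related (∼-trans (∼-sym y₁∼y) (∼-trans y₁∼e′ (∼-trans (∼-sym z₁∼e′) z₁∼z)))))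

  module Segments {κ} (reps : Representatives (suc κ)) where
    open Representatives reps

    -- The invariant of the construction: a segment runs through the quotient line from one endpoint
    -- to the other.
    record Segment (s : ℕ) : Set where
      field
        end      : s + suc κ ≤ n
        distinct : Distinct s (suc κ)
        first    : Endpoint s (suc s)
        last     : Endpoint (s + suc κ) (s + κ)

    initial : Segment 0
    initial = record { end = bound ; distinct = distinct ; first = endpoint first ; last = endpoint last }
      where
      first : ∀ {y} → 0 R y → y ≤ n → y ∼ 0 ⊎ y ∼ 1
      first {y} 0Ry y≤n with R-cases 0 y 0Ry
      ... | inj₁ refl = inj₁ (∼-refl y≤n)
      ... | inj₂ (inj₁ refl) = inj₂ (∼-refl y≤n)
      last : ∀ {y} → suc κ R y → y ≤ n → y ∼ suc κ ⊎ y ∼ κ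
      last {y} kRy y≤n with R-cases (suc κ) y kRy
      ... | inj₁ refl = inj₁ (∼-refl y≤n)
      ... | inj₂ (inj₂ refl) = inj₂ (∼-refl y≤n)
      ... | inj₂ (inj₁ refl) with repeat
      ...   | inj₁ refl = contradiction y≤n (<-irrefl refl)
      -- With `K = suc κ`, the point `K + 1` is related to some `w ≤ K`. By zigzag `w` has a
      -- neighbour related to `K`, which forces `w` to be `K` or `K - 1`.
      ...   | inj₂ (w , w≤K , w∼) with ∼-zigzag w∼ (R-pred (suc κ)) bound
      ...     | v , wRv , v∼K with v ≤? suc κ
      ...       | no v≰K with R-cases w v wRv
      ...         | inj₁ refl = contradiction w≤K v≰K
      ...         | inj₂ (inj₂ refl) = contradiction (<⇒≤ w≤K) v≰K
      ...         | inj₂ (inj₁ refl) = inj₁ (∼-trans (∼-sym w∼) (∼-reflexive (leftBound w∼) (≤-antisym w≤K (s≤s⁻¹ (≰⇒> v≰K)))))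
      last {y} kRy y≤n | inj₂ (inj₁ refl) | inj₂ (w , w≤K , w∼) | v , wRv , v∼K | yes v≤K with distinct v≤K ≤-refl v∼K
      ... | refl with R-cases w (suc κ) wRv
      ...   | inj₁ refl = inj₁ (∼-sym w∼)
      ...   | inj₂ (inj₁ refl) = inj₂ (∼-sym w∼)
      ...   | inj₂ (inj₂ refl) = contradiction w≤K (<-irrefl refl)

    rest? : ∀ r → Dec (r ∼ suc r)
    rest? r = r ∼? suc r

    bit : ∀ {A : Set} → Dec A → ℕ
    bit (yes _) = 1
    bit (no _)  = 0

    start : ℕ → ℕ
    start zero    = 0
    start (suc i) = start i + suc κ + bit (rest? (start i + suc κ))

    module _ {s} (segment : Segment s) (s<n : s + suc κ < n) where
      private
        module segment = Segment segment
        e = s + suc κ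

        e≁ : ¬ e ∼ (s + κ)
        e≁ e∼ = 1+n≢n (segment.distinct ≤-refl (n≤1+n κ) e∼)

        s+κ≤n : s + κ ≤ n
        s+κ≤n = ≤-trans (+-monoʳ-≤ s (n≤1+n κ)) segment.end

        -- `e` has the neighbour `s + κ` in another class, so `e + 1` needs a neighbour in that
        -- class, and only `e + 2` is left.
        after-rest : e ∼ suc e → suc (suc e) ∼ (s + κ)
        after-rest e∼ with ∼-zigzag (∼-sym e∼) (subst (_R (s + κ)) (sym (+-suc s κ)) (R-pred (s + κ))) s+κ≤n
        ... | y , eRy , y∼ with R-cases (suc e) y eRy
        ...   | inj₁ refl        = contradiction (∼-trans e∼ y∼) e≁
        ...   | inj₂ (inj₁ refl) = y∼
        ...   | inj₂ (inj₂ refl) = contradiction y∼ e≁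

        next-step : (rest : Dec (e ∼ suc e)) → (e + bit rest) ∼ e × suc (e + bit rest) ∼ (s + κ)
        next-step (no ¬rest) = ∼-reflexive (subst (_≤ n) (sym (+-identityʳ e)) segment.end) (+-identityʳ e)
          , subst (λ m → suc m ∼ (s + κ)) (sym (+-identityʳ e)) next
          where
          next : suc e ∼ (s + κ)
          next with segment.last (∼-refl segment.end) (R-suc e) s<n
          ... | inj₁ rest = contradiction (∼-sym rest) ¬rest
          ... | inj₂ back = back
        next-step (yes rest) = subst (_∼ e) (+-comm 1 e) (∼-sym rest)
          , subst (λ m → suc m ∼ (s + κ)) (+-comm 1 e) (after-rest rest)

      private
        -- Two consecutive folded points fix the direction: zigzag demands a neighbour related to
        -- `s + z`, and the other two candidates are related to different points of the segment.
        advance : ∀ {t y z} → suc (suc z) ≤ suc κ → (t + y) ∼ (s + suc (suc z)) → (t + suc y) ∼ (s + suc z) →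
                  (t + suc (suc y)) ∼ (s + z)
        advance {t} {y} {z} z+2≤ previous current
          with ∼-zigzag current (subst (_R (s + z)) (sym (+-suc s z)) (R-pred (s + z)))
                 (≤-trans (+-monoʳ-≤ s (≤-trans (n≤1+n z) (<⇒≤ z+2≤))) segment.end)
        ... | x , tRx , x∼ with R-cases (t + suc y) x tRx
        ...   | inj₁ refl = contradiction
                  (segment.distinct (<⇒≤ z+2≤) (≤-trans (n≤1+n z) (<⇒≤ z+2≤)) (∼-trans (∼-sym current) x∼)) 1+n≢n
        ...   | inj₂ (inj₁ refl) = subst (_∼ (s + z)) (sym (+-suc t (suc y))) x∼
        ...   | inj₂ (inj₂ x≡) = contradiction
                  (segment.distinct z+2≤ (≤-trans (n≤1+n z) (<⇒≤ z+2≤))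
                    (∼-trans (∼-sym previous) (subst (_∼ (s + z)) (suc-injective (trans x≡ (+-suc t y))) x∼)))
                  λ bad → <⇒≢ (s≤s (n≤1+n z)) (sym bad)

      next-reflect : ∀ y {z} → y + z ≡ suc κ → (e + bit (rest? e) + y) ∼ (s + z)
      next-reflect zero refl = subst (_∼ e) (sym (+-identityʳ _)) (proj₁ (next-step (rest? e)))
      next-reflect (suc zero) refl = subst (_∼ (s + κ)) (+-comm 1 _) (proj₂ (next-step (rest? e)))
      next-reflect (suc (suc y)) {z} eq =
        advance (subst (suc (suc z) ≤_) eq (s≤s (s≤s (m≤n+m z y))))
          (next-reflect y (trans (+-suc y (suc z)) (cong suc (trans (+-suc y z) (suc-injective eq)))))
          (next-reflect (suc y) (trans (cong suc (+-suc y z)) eq))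

      next-segment : Segment (e + bit (rest? e))
      next-segment = record
        { end      = leftBound (next-reflect (suc κ) (+-identityʳ _))
        ; distinct = λ {y} {z} y≤ z≤ y∼z → ∸-cancelˡ-≡ y≤ z≤ (segment.distinct (m∸n≤m (suc κ) y) (m∸n≤m (suc κ) z)
                       (∼-trans (∼-sym (next-reflect y (m+[n∸m]≡n y≤))) (∼-trans y∼z (next-reflect z (m+[n∸m]≡n z≤)))))
        -- Reflection exchanges the ends: the new segment starts in the class where the old one
        -- ended, and conversely.
        ; first    = endpoint-resp (∼-sym (proj₁ (next-step (rest? e)))) (∼-sym (proj₂ (next-step (rest? e)))) segment.last
        ; last     = endpoint-resp
            (∼-sym (subst ((e + bit (rest? e) + suc κ) ∼_) (+-identityʳ s) (next-reflect (suc κ) (+-identityʳ _))))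
            (∼-sym (subst ((e + bit (rest? e) + κ) ∼_) (+-comm s 1) (next-reflect κ (+-comm κ 1)))) segment.first
        }

    start-< : ∀ i → start i + suc κ ≤ start (suc i)
    start-< i = m≤m+n _ _

    segment : ∀ i → start i + suc κ ≤ n → Segment (start i)
    segment zero    _   = initial
    segment (suc i) ≤n = next-segment (segment i (<⇒≤ before)) before
      where
      before : start i + suc κ < n
      before = <-≤-trans (m<m+n _ z<s) (≤-trans (+-monoˡ-≤ (suc κ) (start-< i)) ≤n)

    -- While a segment ends before `n`, a whole further one fits, so the process stops only exactly
    -- at `n`. The starts increase strictly, which lets `fuel` decrease.
    final : ∀ fuel i → n ≤ start i + fuel → start i + suc κ ≤ n → ∃ λ F → start F + suc κ ≡ n
    final fuel i n≤ ≤n with m≤n⇒m<n∨m≡n ≤n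
    ... | inj₂ ≡n = i , ≡n
    final zero i n≤ ≤n | inj₁ <n =
      contradiction (≤-<-trans (subst (n ≤_) (+-identityʳ _) n≤) (≤-<-trans (m≤m+n (start i) (suc κ)) <n)) (<-irrefl refl)
    final (suc fuel) i n≤ ≤n | inj₁ <n = final fuel (suc i)
      (≤-trans (subst (n ≤_) (+-suc (start i) fuel) n≤) (+-monoˡ-≤ fuel (≤-trans (m<m+n (start i) z<s) (start-< i))))
      (Segment.end (next-segment (segment i ≤n) <n))

    start-mono : ∀ {i j} → i ≤ j → start i ≤ start j
    start-mono {j = j} i≤j with m≤n⇒m<n∨m≡n i≤j
    start-mono {j = suc j} i≤j | inj₁ (s≤s i≤j′) = ≤-trans (start-mono i≤j′) (≤-trans (m≤m+n _ _) (start-< j))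
    start-mono             i≤j | inj₂ refl = ≤-refl

    number : ∃ λ F → start F + suc κ ≡ n
    number = final n 0 ≤-refl bound

    private
      F = proj₁ number

      segment-≤ : ∀ {i} → i ≤ F → Segment (start i)
      segment-≤ {i} i≤F = segment i (≤-trans (+-monoˡ-≤ (suc κ) (start-mono i≤F)) (≤-reflexive (proj₂ number)))

      segment-< : ∀ {i} → i < F → start i + suc κ < n
      segment-< {i} i<F = <-≤-trans (m<m+n _ z<s)
        (≤-trans (+-monoˡ-≤ (suc κ) (≤-trans (start-< i) (start-mono i<F))) (≤-reflexive (proj₂ number)))

    bit-cases : ∀ {A : Set} (A? : Dec A) → (bit A? ≡ 0 × ¬ A) ⊎ (bit A? ≡ 1 × A)
    bit-cases (yes a) = inj₂ (refl , a)
    bit-cases (no ¬a) = inj₁ (refl , ¬a)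

    shape : Shape n _∼_
    shape = record
      { κ = κ ; F = F ; S = start ; b = λ i → bit (rest? (start i + suc κ))
      ; S-zero = refl ; S-suc = λ _ → refl ; S-end = proj₂ number
      ; b-cases = λ i _ → bit-cases (rest? (start i + suc κ))
      ; reflect = λ {i} {y} i<F → next-reflect (segment-≤ (<⇒≤ i<F)) (segment-< i<F) y
      ; inner = λ {i} {y} i≤F y<k rest → 1+n≢n (sym
          (Segment.distinct (segment-≤ i≤F) (<⇒≤ y<k) y<k (subst ((start i + y) ∼_) (sym (+-suc (start i) y)) rest)))
      }

    start-extreme : ∀ {i} → i ≤ F → Extreme θ (start i)
    start-extreme i≤F = endpoint-extreme (≤-trans (m≤m+n _ _) (Segment.end (segment-≤ i≤F))) (Segment.first (segment-≤ i≤F))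

-- Patterns of rests

height-cong : ∀ {C D : ℕ → Set} (C? : Decidable C) (D? : Decidable D) N →
              (∀ {r} → r < N → C r ⇔ D r) → height C? N ≡ height D? N
height-cong C? D? zero    _   = refl
height-cong C? D? (suc N) C⇔D =
  cong₂ _+_ (height-cong C? D? N (λ r<N → C⇔D (<-trans r<N ≤-refl))) (gap-cong (C? N) (D? N) (C⇔D ≤-refl))

even⊎odd : ∀ m → (∃ λ j → m ≡ 2 * j) ⊎ (∃ λ j → m ≡ suc (2 * j))
even⊎odd zero = inj₁ (0 , refl)
even⊎odd (suc m) with even⊎odd m
... | inj₁ (j , refl) = inj₂ (j , refl)
... | inj₂ (j , refl) = inj₁ (suc j , cong suc (sym (+-suc j (j + 0))))

even-∣ : ∀ {m j} → m ≡ 2 * j → 2 ∣ m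
even-∣ {j = j} m≡ = divides j (trans m≡ (*-comm 2 j))

odd-∤ : ∀ {m j} → m ≡ suc (2 * j) → ¬ 2 ∣ m
odd-∤ {j = j} refl 2∣ with ∣m+n∣m⇒∣n (subst (2 ∣_) (+-comm 1 (2 * j)) 2∣) (divides j (*-comm 2 j))
... | divides zero ()
... | divides (suc _) ()

steps-mono : ∀ {f : ℕ → ℕ} → (∀ i → f i < f (suc i)) → ∀ {i j} → i < j → f i < f j
steps-mono step {i} {suc j} (s≤s i≤j) with m≤n⇒m<n∨m≡n i≤j
... | inj₁ i<j  = <-trans (steps-mono step i<j) (step j)
... | inj₂ refl = step i

strict-injective : ∀ {f : ℕ → ℕ} → (∀ {i j} → i < j → f i < f j) → ∀ {i j} → f i ≡ f j → i ≡ j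
strict-injective mono {i} {j} eq with i ≟ j
... | yes i≡j = i≡j
... | no i≢j with ≤-total i j
...   | inj₁ i≤j = contradiction eq (<⇒≢ (mono (≤∧≢⇒< i≤j i≢j)))
...   | inj₂ j≤i = contradiction (sym eq) (<⇒≢ (mono (≤∧≢⇒< j≤i (λ j≡i → i≢j (sym j≡i)))))

module Profile {n} (θ : Congruence n) (nontrivial : 2 ≤ numClasses θ) where
  open Classes θ public

  private
    positive-representatives : ∃ λ κ → Representatives (suc κ)
    positive-representatives with representatives
    ... | zero  , reps = contradiction (subst (2 ≤_) (numClasses≡ reps) nontrivial) λ { (s≤s ()) }
    ... | suc κ , reps = κ , reps

    reps = proj₂ positive-representatives

  open Segments reps using (rest?) public

  abstract
    shape : Shape n _∼_
    shape = Segments.shape reps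

    kOf≡ : kOf θ ≡ suc (Shape.κ shape)
    kOf≡ = cong (_∸ 1) (numClasses≡ reps)

    turn-extreme : ∀ {i} → i ≤ Shape.F shape → Extreme θ (Shape.S shape i)
    turn-extreme = Segments.start-extreme reps

  open Shape shape public

  f : ℕ
  f = suc F

  rest-coarsening : Coarsening n _∼_ Rest
  rest-coarsening = record
    { C-bound  = rightBound
    ; C-rest   = λ rest → rest
    ; C-mirror = λ sx∼y x∼sy → mk⇔ (λ rest → ∼-trans (∼-sym sx∼y) (∼-trans (∼-sym rest) x∼sy))
                                   (λ rest → ∼-trans x∼sy (∼-trans (∼-sym rest) (∼-sym sx∼y)))
    }

  ∈-rests⁻ : ∀ {r} → r ∈ rests θ → r < n × Rest r
  ∈-rests⁻ r∈ with ∈-filter⁻ _ r∈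
  ... | r∈upTo , r≈ = ∈-upTo⁻ r∈upTo , mk∼ (<⇒≤ (∈-upTo⁻ r∈upTo)) (∈-upTo⁻ r∈upTo) r≈

  ∈-rests⁺ : ∀ {r} → Rest r → r ∈ rests θ
  ∈-rests⁺ rest = ∈-filter⁺ _ (∈-upTo⁺ (rightBound rest)) (related rest)

  -- With the rests of θ itself in the role of C, the height of n is n ∸ mOf θ.
  freq≡ : freq θ ≡ f
  freq≡ = begin
    div′ (n ∸ mOf θ) (kOf θ)             ≡⟨ cong (div′ (n ∸ mOf θ)) kOf≡ ⟩
    (n ∸ mOf θ) / suc κ                  ≡⟨ cong (_/ suc κ) n∸m≡ ⟩
    (f * suc κ) / suc κ                  ≡⟨ m*n/n≡m f (suc κ) ⟩
    f                                    ∎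
    where
    open ≡-Reasoning
    open Heights shape rest? rest-coarsening using (h; height-total)
    ≈? : Decidable (λ r → Congruence._≈_ θ r (suc r))
    ≈? r = Congruence.dec θ r (suc r)
    first-free : ∀ {r} → r < suc κ → ¬ Rest r
    first-free {r} r<k = subst (λ s → ¬ Rest (s + r)) S-zero (inner z≤n r<k)
    h≡ : h ≡ suc κ
    h≡ = height-none rest? 0 (suc κ) first-free
    n∸m≡ : n ∸ mOf θ ≡ f * suc κ
    n∸m≡ = begin
      n ∸ mOf θ                              ≡⟨ cong (_∸ mOf θ) (length-filter-height ≈? n) ⟨
      mOf θ + height ≈? n ∸ mOf θ            ≡⟨ m+n∸m≡n (mOf θ) _ ⟩
      height ≈? n                            ≡⟨ height-cong ≈? rest? n (λ r<n → mk⇔ (mk∼ (<⇒≤ r<n) r<n) related) ⟩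
      height rest? n                         ≡⟨ height-total ⟩
      f * h                                  ≡⟨ cong (f *_) h≡ ⟩
      f * suc κ                              ∎

  no-rests : (∀ {i} → i < F → b i ≢ 1) → NoRests θ
  no-rests none = empty (rests θ) λ r∈ →
    let r<n , rest = ∈-rests⁻ r∈ ; i , i<F , b≡1 , _ = rest-turn r<n rest in none i<F b≡1
    where
    empty : ∀ xs → (∀ {r : ℕ} → ¬ r ∈ xs) → xs ≡ []
    empty []       _  = refl
    empty (x ∷ xs) ∉ = contradiction (here refl) ∉

  -- `g` is the defining formula, counted from 1; `G` is the same sequence counted from 0; `ι j` is
  -- the segment after which rest number `j` occurs.
  rests-by : ∀ (g G ι : ℕ → ℕ) → (∀ j → g (suc j) ≡ G j) → (∀ j → G j < G (suc j)) → (∀ j → ι j < ι (suc j)) →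
             (∀ {j} → ι j < F → G j ≡ S (ι j) + suc κ) → (∀ {j} → ι j < F → b (ι j) ≡ 1) →
             (∀ {i} → i < F → b i ≡ 1 → ∃ λ j → i ≡ ι j) → ι 0 < F → RestsBy θ g
  rests-by g G ι g≡G G-step ι-step G≡ ones only ι0<F = nonempty (rests θ) (member ι0<F) ,
    trans (sorted-progression G G-mono sorted onto closed)
      (trans (sym (map-upTo G _)) (map-cong (λ j → sym (g≡G j)) (upTo (mOf θ))))
    where
    G-mono : ∀ {i j} → i < j → G i < G j
    G-mono = steps-mono {G} G-step
    nonempty : ∀ {x : ℕ} xs → x ∈ xs → 1 ≤ length xs
    nonempty (_ ∷ _) _ = s≤s z≤n
    sorted : AllPairs _<_ (rests θ)
    sorted = AllPairs.filter⁺ _ (AllPairs.applyUpTo⁺₁ (λ r → r) n λ i<j _ → i<j)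
    member : ∀ {j} → ι j < F → G j ∈ rests θ
    member {j} ιj<F with b-cases (ι j) ιj<F
    ... | inj₁ (b≡0 , _) = contradiction (trans (sym b≡0) (ones ιj<F)) λ ()
    ... | inj₂ (_ , rest) = subst (_∈ rests θ) (sym (G≡ ιj<F)) (∈-rests⁺ rest)
    index : ∀ {r} → r ∈ rests θ → ∃ λ j → ι j < F × r ≡ G j
    index r∈ with ∈-rests⁻ r∈
    ... | r<n , rest with rest-turn r<n rest
    ...   | i , i<F , b≡1 , r≡ with only i<F b≡1
    ...     | j , refl = j , i<F , trans r≡ (sym (G≡ i<F))
    onto : ∀ {r} → r ∈ rests θ → ∃ λ j → r ≡ G j
    onto r∈ = let j , _ , r≡ = index r∈ in j , r≡
    closed : ∀ j → G (suc j) ∈ rests θ → G j ∈ rests θ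
    closed j G∈ with index G∈
    ... | j′ , ιj′<F , G≡G with strict-injective G-mono {suc j} {j′} G≡G
    ...   | refl = member (<-trans (ι-step j) ιj′<F)

  -- P₁ and P₂ govern the odd and the even turning points (b i belongs to turning point i + 1).
  record Pattern (P₁ P₂ : Set) : Set where
    field
      odd-turn  : ∀ j → 2 * j < F → b (2 * j) ≡ 1 ⇔ P₁
      even-turn : ∀ j → suc (2 * j) < F → b (suc (2 * j)) ≡ 1 ⇔ P₂

  bit-value : ∀ {i} {P : Set} → i < F → b i ≡ 1 ⇔ P → ¬ P → b i ≡ 0
  bit-value i<F b⇔P ¬p with b-cases _ i<F
  ... | inj₁ (b≡0 , _) = b≡0
  ... | inj₂ (b≡1 , _) = contradiction (to b⇔P b≡1) ¬p

  module _ {P₁ P₂ : Set} (pattern′ : Pattern P₁ P₂) where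
    open Pattern pattern′

    decide-odd : 0 < F → Dec P₁
    decide-odd 0<F = map′ (to (odd-turn 0 0<F)) (from (odd-turn 0 0<F)) (b 0 ≟ 1)

    decide-even : 1 < F → Dec P₂
    decide-even 1<F = map′ (to (even-turn 0 1<F)) (from (even-turn 0 1<F)) (b 1 ≟ 1)

    -- Two segments with their rests form one period. For rests on top or on the bottom exactly one
    -- of `β₁`, `β₂` is 1, hence the factor `2 * kOf θ + 1` in both formulas.
    S-double : ∀ β₁ β₂ → (∀ j → 2 * j < F → b (2 * j) ≡ β₁) → (∀ j → suc (2 * j) < F → b (suc (2 * j)) ≡ β₂) →
               ∀ j → 2 * j ≤ F → S (2 * j) ≡ (2 * suc κ + (β₁ + β₂)) * j
    S-double β₁ β₂ odd even zero _ = trans S-zero (sym (*-zeroʳ (2 * suc κ + (β₁ + β₂))))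
    S-double β₁ β₂ odd even (suc j) 2+2j≤F = begin
      S (2 * suc j)                                                 ≡⟨ cong S 2+2j≡ ⟩
      S (suc (suc (2 * j)))                                         ≡⟨ S-suc _ ⟩
      S (suc (2 * j)) + suc κ + b (suc (2 * j))                     ≡⟨ cong₂ (λ x y → x + suc κ + y) (S-suc _) (even j <F) ⟩
      S (2 * j) + suc κ + b (2 * j) + suc κ + β₂
        ≡⟨ cong₂ (λ x y → x + suc κ + y + suc κ + β₂) (S-double β₁ β₂ odd even j (<⇒≤ (<⇒≤ <F))) (odd j (<⇒≤ <F)) ⟩
      (2 * suc κ + (β₁ + β₂)) * j + suc κ + β₁ + suc κ + β₂         ≡⟨ e (suc κ) β₁ β₂ j ⟩
      (2 * suc κ + (β₁ + β₂)) * suc j                               ∎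
      where
      open ≡-Reasoning
      2+2j≡ : 2 * suc j ≡ suc (suc (2 * j))
      2+2j≡ = cong suc (+-suc j (j + 0))
      <F : suc (2 * j) < F
      <F = subst (_≤ F) 2+2j≡ 2+2j≤F
      e : ∀ k β₁ β₂ j → (2 * k + (β₁ + β₂)) * j + k + β₁ + k + β₂ ≡ (2 * k + (β₁ + β₂)) * suc j
      e = solve-∀

    neither : ¬ P₁ → ¬ P₂ → NoRests θ
    neither ¬p₁ ¬p₂ = no-rests none
      where
      none : ∀ {i} → i < F → b i ≢ 1
      none {i} i<F b≡1 with even⊎odd i
      ... | inj₁ (j , refl) = ¬p₁ (to (odd-turn j i<F) b≡1)
      ... | inj₂ (j , refl) = ¬p₂ (to (even-turn j i<F) b≡1)

    even-index : ¬ P₂ → ∀ {i} → i < F → b i ≡ 1 → ∃ λ j → i ≡ 2 * j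
    even-index ¬p₂ {i} i<F b≡1 with even⊎odd i
    ... | inj₁ found = found
    ... | inj₂ (j , refl) = contradiction (to (even-turn j i<F) b≡1) ¬p₂

    odd-index : ¬ P₁ → ∀ {i} → i < F → b i ≡ 1 → ∃ λ j → i ≡ suc (2 * j)
    odd-index ¬p₁ {i} i<F b≡1 with even⊎odd i
    ... | inj₂ found = found
    ... | inj₁ (j , refl) = contradiction (to (odd-turn j i<F) b≡1) ¬p₁

    -- With `k = suc κ`, rest number `j`, counted from 0, follows segment `2 * j` and stands at `(2k
    -- + 1) j + k = (2k + 1) (j + 1) - k - 1`.
    on-top : 0 < F → P₁ → ¬ P₂ → RestsOnTop θ
    on-top 0<F p₁ ¬p₂ = rests-by (λ i → (2 * kOf θ + 1) * i ∸ kOf θ ∸ 1)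
      (λ j → (2 * suc κ + 1) * j + suc κ) (λ j → 2 * j) formula
      (λ j → +-monoˡ-< (suc κ) (*-monoʳ-< (2 * suc κ + 1) (n<1+n j))) (λ j → *-monoʳ-< 2 (n<1+n j))
      (λ {j} 2j<F → cong (_+ suc κ) (sym (S-double 1 0 ones (λ i i<F → bit-value i<F (even-turn i i<F) ¬p₂) j (<⇒≤ 2j<F))))
      (λ {j} → ones j) (even-index ¬p₂) 0<F
      where
      open ≡-Reasoning
      ones : ∀ j → 2 * j < F → b (2 * j) ≡ 1
      ones j 2j<F = from (odd-turn j 2j<F) p₁
      e : ∀ κ j → (2 * suc κ + 1) * suc j ≡ suc κ + (1 + ((2 * suc κ + 1) * j + suc κ))
      e = solve-∀
      formula : ∀ j → (2 * kOf θ + 1) * suc j ∸ kOf θ ∸ 1 ≡ (2 * suc κ + 1) * j + suc κ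
      formula j = begin
        (2 * kOf θ + 1) * suc j ∸ kOf θ ∸ 1   ≡⟨ cong (λ k → (2 * k + 1) * suc j ∸ k ∸ 1) kOf≡ ⟩
        (2 * suc κ + 1) * suc j ∸ suc κ ∸ 1   ≡⟨ cong (λ x → x ∸ suc κ ∸ 1) (e κ j) ⟩
        suc κ + (1 + ((2 * suc κ + 1) * j + suc κ)) ∸ suc κ ∸ 1 ≡⟨ cong (_∸ 1) (m+n∸m≡n (suc κ) _) ⟩
        (2 * suc κ + 1) * j + suc κ           ∎

    -- The rest follows segment `2 * j + 1`, which is joined to its predecessor:
    -- `(2k + 1) j + 2k = (2k + 1) (j + 1) - 1`. By `1 < F` there is at least one.
    on-bottom : 1 < F → ¬ P₁ → P₂ → RestsOnBottom θ
    on-bottom 1<F ¬p₁ p₂ = rests-by (λ i → (2 * kOf θ + 1) * i ∸ 1)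
      (λ j → (2 * suc κ + 1) * j + (suc κ + suc κ)) (λ j → suc (2 * j)) formula
      (λ j → +-monoˡ-< (suc κ + suc κ) (*-monoʳ-< (2 * suc κ + 1) (n<1+n j))) (λ j → s<s (*-monoʳ-< 2 (n<1+n j)))
      (λ {j} 1+2j<F → begin
        (2 * suc κ + 1) * j + (suc κ + suc κ)    ≡⟨ +-assoc ((2 * suc κ + 1) * j) (suc κ) (suc κ) ⟨
        (2 * suc κ + 1) * j + suc κ + suc κ      ≡⟨ cong (λ x → x + suc κ + suc κ) (S-double 0 1 zeros (λ i i<F → from (even-turn i i<F) p₂) j (<⇒≤ (<⇒≤ 1+2j<F))) ⟨
        S (2 * j) + suc κ + suc κ                ≡⟨ cong (_+ suc κ) (S-joined (<⇒≤ 1+2j<F) (zeros j (<⇒≤ 1+2j<F))) ⟨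
        S (suc (2 * j)) + suc κ                  ∎)
      (λ {j} i<F → from (even-turn j i<F) p₂) (odd-index ¬p₁) 1<F
      where
      open ≡-Reasoning
      zeros : ∀ j → 2 * j < F → b (2 * j) ≡ 0
      zeros j 2j<F = bit-value 2j<F (odd-turn j 2j<F) ¬p₁
      e : ∀ κ j → (2 * suc κ + 1) * suc j ≡ 1 + ((2 * suc κ + 1) * j + (suc κ + suc κ))
      e = solve-∀
      formula : ∀ j → (2 * kOf θ + 1) * suc j ∸ 1 ≡ (2 * suc κ + 1) * j + (suc κ + suc κ)
      formula j = trans (cong (λ k → (2 * k + 1) * suc j ∸ 1) kOf≡) (cong (_∸ 1) (e κ j))

    everywhere : 0 < F → P₁ → P₂ → RestsEverywhere θ
    everywhere 0<F p₁ p₂ = rests-by (λ i → (kOf θ + 1) * i ∸ 1) (λ i → (suc κ + 1) * i + suc κ) (λ i → i) formula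
      (λ i → +-monoˡ-< (suc κ) (*-monoʳ-< (suc κ + 1) (n<1+n i))) n<1+n
      (λ {i} i<F → cong (_+ suc κ) (sym (S-everywhere i (<⇒≤ i<F)))) ones (λ {i} _ _ → i , refl) 0<F
      where
      open ≡-Reasoning
      ones : ∀ {i} → i < F → b i ≡ 1
      ones {i} i<F with even⊎odd i
      ... | inj₁ (j , refl) = from (odd-turn j i<F) p₁
      ... | inj₂ (j , refl) = from (even-turn j i<F) p₂
      e₀ : ∀ κ i → suc ((suc κ + 1) * i + suc κ) ≡ (suc κ + 1) * suc i
      e₀ = solve-∀
      S-everywhere : ∀ i → i ≤ F → S i ≡ (suc κ + 1) * i
      S-everywhere zero    _   = trans S-zero (sym (*-zeroʳ (suc κ + 1)))
      S-everywhere (suc i) i<F =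
        trans (S-separated i<F (ones i<F)) (trans (cong (λ x → suc (x + suc κ)) (S-everywhere i (<⇒≤ i<F))) (e₀ κ i))
      formula : ∀ i → (kOf θ + 1) * suc i ∸ 1 ≡ (suc κ + 1) * i + suc κ
      formula i = trans (cong (λ k → (k + 1) * suc i ∸ 1) kOf≡) (cong (_∸ 1) (sym (e₀ κ i)))

  module _ (T : ℕ → Set) {g : ℕ} (2<f : 2 < f) (2<g : 2 < g) (coprime : Coprime f g)
           (mirror : Mirroring T f g) (mirror′ : Mirroring T g f) (b⇔T : ∀ {i} → i < F → b i ≡ 1 ⇔ T (g * suc i)) where

    private
      turn : ∀ {i} c e → 0 < c → c ≤ 2 → g * suc i ≡ c + 2 * e → i < F → b i ≡ 1 ⇔ T c
      turn c e 0<c c≤2 eq i<F = ⇔-trans (b⇔T i<F) (turn-parity T coprime 2<f 2<g mirror mirror′ e z<s (s<s i<F) 0<c c≤2 eq)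

    -- For odd `g` the number `g * suc i` has the parity of `suc i`. The witnesses are half the
    -- differences from 1 and 2.
    odd-pattern : ∀ m → g ≡ suc (2 * m) → Pattern (T 1) (T 2)
    odd-pattern m refl = record
      { odd-turn  = λ j → turn 1 (j + m * suc (2 * j)) z<s (s≤s z≤n) (e₁ m j)
      ; even-turn = λ j → turn 2 (j + 2 * m * suc j) z<s ≤-refl (e₂ m j)
      }
      where
      e₁ : ∀ m j → suc (2 * m) * suc (2 * j) ≡ 1 + 2 * (j + m * suc (2 * j))
      e₁ = solve-∀
      e₂ : ∀ m j → suc (2 * m) * suc (suc (2 * j)) ≡ 2 + 2 * (j + 2 * m * suc j)
      e₂ = solve-∀

    even-pattern : ∀ m → g ≡ 2 * m → Pattern (T 2) (T 2)
    even-pattern zero refl = contradiction 2<g λ ()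
    even-pattern (suc m) refl = record
      { odd-turn  = λ j → turn 2 (m + 2 * j + m * (2 * j)) z<s ≤-refl (e m (2 * j))
      ; even-turn = λ j → turn 2 (m + suc (2 * j) + m * suc (2 * j)) z<s ≤-refl (e m (suc (2 * j)))
      }
      where
      e : ∀ m i → 2 * suc m * suc i ≡ 2 + 2 * (m + i + m * i)
      e = solve-∀

-- The join of two congruences

module Joins {n} (θ δ : Congruence n) where
  private
    module θ = Classes θ
    module δ = Classes δ

  JoinEdge : ℕ → Set
  JoinEdge r = r < n × Join θ δ r (suc r)

  join-θ : ∀ {x y} → x θ.∼ y → Join θ δ x y
  join-θ (θ.mk∼ x≤n y≤n x≈y) = (x≤n , y≤n , inj₁ x≈y) ◅ ε

  join-δ : ∀ {x y} → x δ.∼ y → Join θ δ x y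
  join-δ (δ.mk∼ x≤n y≤n x≈y) = (x≤n , y≤n , inj₂ x≈y) ◅ ε

  join-sym : ∀ {x y} → Join θ δ x y → Join θ δ y x
  join-sym = reverse λ where
    (x≤n , y≤n , inj₁ x≈y) → y≤n , x≤n , inj₁ (Congruence.sym θ x≤n y≤n x≈y)
    (x≤n , y≤n , inj₂ x≈y) → y≤n , x≤n , inj₂ (Congruence.sym δ x≤n y≤n x≈y)

  join-zigzag : ∀ {x x′ y} → Join θ δ x′ x → x R y → y ≤ n → ∃ λ y′ → y′ ≤ n × x′ R y′ × Join θ δ y′ y
  join-zigzag ε xRy y≤n = _ , y≤n , xRy , ε
  join-zigzag ((x′≤n , w≤n , x′∪w) ◅ w⋆x) xRy y≤n with join-zigzag w⋆x xRy y≤n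
  join-zigzag ((x′≤n , w≤n , inj₁ x′≈w) ◅ w⋆x) xRy y≤n | v , v≤n , wRv , v⋆y =
    let y′ , x′Ry′ , y′∼v = θ.∼-zigzag (θ.mk∼ x′≤n w≤n x′≈w) wRv v≤n
    in y′ , θ.leftBound y′∼v , x′Ry′ , join-θ y′∼v ◅◅ v⋆y
  join-zigzag ((x′≤n , w≤n , inj₂ x′≈w) ◅ w⋆x) xRy y≤n | v , v≤n , wRv , v⋆y =
    let y′ , x′Ry′ , y′∼v = δ.∼-zigzag (δ.mk∼ x′≤n w≤n x′≈w) wRv v≤n
    in y′ , δ.leftBound y′∼v , x′Ry′ , join-δ y′∼v ◅◅ v⋆y

  -- By zigzag, if the neighbours of one point stay in its class, so do the neighbours of every
  -- point of that class; the class then spreads over the line.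
  isolated⇒full : ∀ {z} → z ≤ n → (∀ {y} → z R y → y ≤ n → Join θ δ y z) → JoinIsFull θ δ
  isolated⇒full {z} z≤ near x y x≤n y≤n = up x x≤n ◅◅ join-sym (up y y≤n)
    where
    spread : ∀ {x y} → Join θ δ x z → x R y → y ≤ n → Join θ δ y z
    spread x⋆z xRy y≤n with join-zigzag (join-sym x⋆z) xRy y≤n
    ... | y′ , y′≤n , zRy′ , y′⋆y = join-sym y′⋆y ◅◅ near zRy′ y′≤n
    down : ∀ x → x ≤ n → Join θ δ x z → Join θ δ 0 z
    down zero    _   x⋆z = x⋆z
    down (suc x) x<n x⋆z = down x (<⇒≤ x<n) (spread x⋆z (R-pred x) (<⇒≤ x<n))
    up : ∀ x → x ≤ n → Join θ δ x z
    up zero    _   = down z z≤ ε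
    up (suc x) x<n = spread (up x (<⇒≤ x<n)) (R-suc x) x<n

  module _ (notFull : ¬ JoinIsFull θ δ) where

    edge-sparse : ∀ {r} → JoinEdge r → ¬ JoinEdge (suc r)
    edge-sparse {r} (r<n , r⋆) (r+1<n , r+1⋆) = notFull (isolated⇒full r<n λ {y} zRy y≤n → near y (R-cases (suc r) y zRy))
      where
      near : ∀ y → y ≡ suc r ⊎ y ≡ suc (suc r) ⊎ suc y ≡ suc r → Join θ δ y (suc r)
      near y (inj₁ refl) = ε
      near y (inj₂ (inj₁ refl)) = join-sym r+1⋆
      near y (inj₂ (inj₂ refl)) = r⋆

    first-not-edge : ¬ JoinEdge 0
    first-not-edge (0<n , 0⋆1) = notFull (isolated⇒full (<⇒≤ 0<n) λ {y} zRy y≤n → near y (R-cases 0 y zRy))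
      where
      near : ∀ y → y ≡ 0 ⊎ y ≡ 1 ⊎ suc y ≡ 0 → Join θ δ y 0
      near y (inj₁ refl) = ε
      near y (inj₂ (inj₁ refl)) = join-sym 0⋆1

    last-not-edge : ∀ {r} → suc r ≡ n → ¬ JoinEdge r
    last-not-edge {r} refl (_ , r⋆n) = notFull (isolated⇒full ≤-refl λ {y} zRy y≤n → near y y≤n (R-cases (suc r) y zRy))
      where
      near : ∀ y → y ≤ suc r → y ≡ suc r ⊎ y ≡ suc (suc r) ⊎ suc y ≡ suc r → Join θ δ y (suc r)
      near y _ (inj₁ refl) = ε
      near y y≤ (inj₂ (inj₁ refl)) = contradiction y≤ 1+n≰n
      near y _ (inj₂ (inj₂ refl)) = r⋆n

  -- Only finitely many steps lie below `n`, so the doubly negated instances of excluded middle can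
  -- be collected by induction.
  ¬¬-edge? : ¬ ¬ (∀ r → Dec (JoinEdge r))
  ¬¬-edge? k = below n λ edge? → k λ r → decide edge? r (r <? n)
    where
    decide : (∀ {r} → r < n → Dec (JoinEdge r)) → ∀ r → Dec (r < n) → Dec (JoinEdge r)
    decide edge? r (yes r<n) = edge? r<n
    decide edge? r (no r≮n)  = no λ (r<n , _) → r≮n r<n
    below : ∀ m → ¬ ¬ (∀ {r} → r < m → Dec (JoinEdge r))
    below zero    k = k λ ()
    below (suc m) k = below m λ edge? → ¬¬-excluded-middle λ m? → k λ {r} r<1+m → extend edge? m? (m≤n⇒m<n∨m≡n (s≤s⁻¹ r<1+m))
      where
      extend : ∀ {r} → (∀ {r} → r < m → Dec (JoinEdge r)) → Dec (JoinEdge m) → r < m ⊎ r ≡ m → Dec (JoinEdge r)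
      extend edge? m? (inj₁ r<m)  = edge? r<m
      extend edge? m? (inj₂ refl) = m?

  join-coarsening : ∀ {_∼_ : ℕ → ℕ → Set} → (∀ {x y} → x ∼ y → x ≤ n × y ≤ n) → (∀ {x y} → x ∼ y → y ∼ x) →
                    (∀ {x y} → x ∼ y → Join θ δ x y) → Coarsening n _∼_ JoinEdge
  join-coarsening bounds sym′ join = record
    { C-bound  = proj₁
    ; C-rest   = λ rest → proj₂ (bounds rest) , join rest
    ; C-mirror = λ sx∼y x∼sy → mk⇔ (λ (_ , x⋆) → proj₂ (bounds x∼sy) , join (sym′ sx∼y) ◅◅ join-sym x⋆ ◅◅ join x∼sy)
                                   (λ (_ , y⋆) → proj₁ (bounds sx∼y) , join x∼sy ◅◅ join-sym y⋆ ◅◅ join (sym′ sx∼y))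
    }

rescale-mirroring : ∀ {T f g h} c → 0 < c → h ≡ c * g → Mirroring T f h → Mirroring (λ x → T (c * x)) f g
rescale-mirroring {T} {f} {g} c 0<c refl mirror i a a′ eq 0<a 0<a′ i<f =
  subst₂ (λ x y → T x ⇔ T y) (e c i g a) (e c (suc i) g a′)
    (mirror i (c * a) (c * a′) (trans (sym (*-distribˡ-+ c a a′)) (cong (c *_) eq)) (positive 0<a) (positive 0<a′) i<f)
  where
  e : ∀ c i g a → i * (c * g) + c * a ≡ c * (i * g + a)
  e = solve-∀
  positive : ∀ {a} → 0 < a → 0 < c * a
  positive {a} 0<a = *-mono-< 0<c 0<a

-- Classification by the parities of the frequencies

Classification : ∀ {n} → Congruence n → Congruence n → Set
Classification θ δ =
  (NoRests θ × NoRests δ)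
    ⊎ ((IsEven θ × RestsOnTop θ × IsOdd δ × NoRests δ)
       ⊎ (IsEven δ × RestsOnTop δ × IsOdd θ × NoRests θ))
    ⊎ (IsOdd θ × RestsOnTop θ × IsOdd δ × RestsOnTop δ)
    ⊎ (((IsEven θ × IsEven δ) ⊎ (IsOdd θ × IsOdd δ))
       × RestsOnBottom θ × RestsOnBottom δ)
    ⊎ ((IsEven θ × RestsOnBottom θ × IsOdd δ × RestsEverywhere δ)
       ⊎ (IsEven δ × RestsOnBottom δ × IsOdd θ × RestsEverywhere θ))
    ⊎ (RestsEverywhere θ × RestsEverywhere δ)

module Theorem {n} (θ δ : Congruence n) (nontrivial-θ : 2 ≤ numClasses θ) (nontrivial-δ : 2 ≤ numClasses δ)
               (k≤l : kOf θ ≤ kOf δ) (notFull : ¬ JoinIsFull θ δ)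
               (common : ∀ e → e ≤ n → Extreme θ e → Extreme δ e → e ≡ 0 ⊎ e ≡ n)
               (edge? : ∀ r → Dec (Joins.JoinEdge θ δ r)) where
  open Joins θ δ
  private
    module θ = Profile θ nontrivial-θ
    module δ = Profile δ nontrivial-δ
    module θH = Heights θ.shape edge? (join-coarsening (λ x∼y → θ.leftBound x∼y , θ.rightBound x∼y) θ.∼-sym join-θ)
    module δH = Heights δ.shape edge? (join-coarsening (λ x∼y → δ.leftBound x∼y , δ.rightBound x∼y) δ.∼-sym join-δ)
    module θS = θH.Sparse (edge-sparse notFull) (first-not-edge notFull) (last-not-edge notFull)
    module δS = δH.Sparse (edge-sparse notFull) (first-not-edge notFull) (last-not-edge notFull)

    f g h h′ : ℕ
    f = θ.f
    g = δ.f
    h = θH.h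
    h′ = δH.h

    H : ℕ → ℕ
    H = height edge?

    fh≡gh′ : f * h ≡ g * h′
    fh≡gh′ = trans (sym θH.height-total) δH.height-total

    -- As heights are monotone, `k ≤ l` gives `h ≤ h′`, so `g * h ≤ g * h′ = f * h`.
    g≤f : g ≤ f
    g≤f = *-cancelʳ-≤ g f h {{>-nonZero θS.h>0}}
      (≤-trans (*-monoʳ-≤ g (height-mono edge? (subst₂ _≤_ θ.kOf≡ δ.kOf≡ k≤l))) (≤-reflexive (sym fh≡gh′)))

  start-unique : ∀ {p q} → ¬ JoinEdge p → ¬ JoinEdge q → H p ≡ H q → p ≡ q
  start-unique {p} {q} ¬p ¬q eq with <-cmp p q
  ... | tri≈ _ p≡q _ = p≡q
  ... | tri< p<q _ _ = contradiction eq (<⇒≢ (subst (_≤ H q) (height-step edge? ¬p) (height-mono edge? p<q)))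
  ... | tri> _ _ q<p = contradiction (sym eq) (<⇒≢ (subst (_≤ H p) (height-step edge? ¬q) (height-mono edge? q<p)))

  -- Turns start steps that are not edges, so equal heights would mean the same point, a common
  -- extreme. Its height lies strictly between 0 and `f * h`, so it is not an end of the line.
  no-common-turn : ∀ {i j} → 0 < i → i < f → j < g → i * h ≢ j * h′
  no-common-turn {i} {j} 0<i i<f@(s≤s i≤F) (s≤s j≤G) eq = not-end (common (θ.S i) (proj₁ extreme) extreme
                                                     (subst (Extreme δ) (sym same-turn) (δ.turn-extreme j≤G)))
    where
    extreme : Extreme θ (θ.S i)
    extreme = θ.turn-extreme i≤F
    same-turn : θ.S i ≡ δ.S j
    same-turn = start-unique (θS.¬C-segment-first i≤F) (δS.¬C-segment-first j≤G)
      (trans (θH.height-S i i≤F) (trans eq (sym (δH.height-S j j≤G))))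
    not-end : ¬ (θ.S i ≡ 0 ⊎ θ.S i ≡ n)
    not-end (inj₁ S≡0) = contradiction (trans (sym (θH.height-S i i≤F)) (cong H S≡0)) (λ eq₀ → <⇒≢ (*-mono-< 0<i θS.h>0) (sym eq₀))
    not-end (inj₂ S≡n) = contradiction (trans (sym (θH.height-S i i≤F)) (trans (cong H S≡n) θH.height-total))
                           (<⇒≢ (*-monoˡ-< h {{>-nonZero θS.h>0}} i<f))

  -- A common divisor d > 1 of f and g gives the common turning point number f / d of θ and g / d of δ.
  coprime : Coprime f g
  coprime {zero} (divides p f≡ , _) = contradiction (trans f≡ (*-zeroʳ p)) λ ()
  coprime {suc zero} _ = refl
  coprime {d@(suc (suc _))} (divides i f≡ , divides j g≡) =
    contradiction (*-cancelˡ-≡ (i * h) (j * h′) d (begin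
      d * (i * h)   ≡⟨ *-assoc d i h ⟨
      d * i * h     ≡⟨ cong (_* h) (trans (*-comm d i) (sym f≡)) ⟩
      f * h         ≡⟨ fh≡gh′ ⟩
      g * h′        ≡⟨ cong (_* h′) (trans g≡ (*-comm j d)) ⟩
      d * j * h′    ≡⟨ *-assoc d j h′ ⟩
      d * (j * h′)  ∎)) (no-common-turn (positive i f≡) (smaller i f≡) (smaller j g≡))
    where
    open ≡-Reasoning
    positive : ∀ {m} i → suc m ≡ i * d → 0 < i
    positive (suc i) _ = z<s
    smaller : ∀ {m} i → suc m ≡ i * d → i < suc m
    smaller (suc i) m≡ = subst (suc i <_) (sym m≡) (m<m*n (suc i) d (s≤s (s≤s z≤n)))

  -- Reversal sends a rest of θ to an edge whose height is `f * h` minus a multiple of `h`, and an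
  -- edge at a multiple of `h` is a rest of θ.
  mirrored : g ≡ 2 → ∀ {r} → r ∈ rests θ → n ∸ r ∸ 1 ∈ rests θ
  mirrored g≡2 {r} r∈ =
    let r<n , rest = θ.∈-rests⁻ r∈
        r′ , r+1+r′≡n , c′ , sum≡ = δS.palindrome (suc-injective g≡2) (r<n , join-θ rest)
        h∣Hn = divides f θH.height-total
        h∣Hr′ = ∣m+n∣m⇒∣n (subst (h ∣_) (sym sum≡) h∣Hn) (θS.rest-height r<n rest)
    in subst (_∈ rests θ) (begin
         r′                         ≡⟨ cong (_∸ 1) (m+n∸m≡n r (suc r′)) ⟨
         r + suc r′ ∸ r ∸ 1         ≡⟨ cong (λ m → m ∸ r ∸ 1) r+1+r′≡n ⟩
         n ∸ r ∸ 1                  ∎) (θ.∈-rests⁺ (θS.height-rest⁻¹ c′ h∣Hr′))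
    where open ≡-Reasoning

  module _ (2<g : 2 < g) where
    private
      2<f : 2 < f
      2<f = <-≤-trans 2<g g≤f

      -- Coprimality and `g ∣ f * h` give `g ∣ h`. In units of `c` the turns of θ lie at multiples
      -- of `g` and those of δ at multiples of `f`.
      scale : ∃ λ c → h ≡ c * g × h′ ≡ c * f
      scale with coprime-divisor (Coprimality.sym coprime) (subst (g ∣_) (sym fh≡gh′) (m∣m*n {g} h′))
      ... | divides c h≡cg = c , h≡cg , *-cancelˡ-≡ h′ (c * f) g (begin
        g * h′         ≡⟨ fh≡gh′ ⟨
        f * h          ≡⟨ cong (f *_) h≡cg ⟩
        f * (c * g)    ≡⟨ e f c g ⟩
        g * (c * f)    ∎)
        where
        open ≡-Reasoning
        e : ∀ f c g → f * (c * g) ≡ g * (c * f)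
        e = solve-∀

      c : ℕ
      c = proj₁ scale

      h≡ : h ≡ c * g
      h≡ = proj₁ (proj₂ scale)

      h′≡ : h′ ≡ c * f
      h′≡ = proj₂ (proj₂ scale)

      0<c : 0 < c
      0<c = n≢0⇒n>0 λ c≡0 → <⇒≢ θS.h>0 (sym (trans h≡ (cong (_* g) c≡0)))

      T : ℕ → Set
      T x = θS.T (c * x)

      mirror : Mirroring T f g
      mirror = rescale-mirroring {θS.T} c 0<c h≡ θS.T-mirroring

      -- `θS.T` and `δS.T` are the same set, the heights of join edges, so the mirrors of δ act on
      -- it too.
      mirror′ : Mirroring T g f
      mirror′ = rescale-mirroring {θS.T} c 0<c h′≡ δS.T-mirroring

      height-of-turn : ∀ i g → suc i * (c * g) ≡ c * (g * suc i)
      height-of-turn i g = e c i g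
        where
        e : ∀ c i g → suc i * (c * g) ≡ c * (g * suc i)
        e = solve-∀

      θ-turn : ∀ {i} → i < θ.F → θ.b i ≡ 1 ⇔ T (g * suc i)
      θ-turn {i} i<F = subst (λ x → θ.b i ≡ 1 ⇔ θS.T x) (trans (cong (suc i *_) h≡) (height-of-turn i g)) (θS.rest-at-turn i<F)

      δ-turn : ∀ {i} → i < δ.F → δ.b i ≡ 1 ⇔ T (f * suc i)
      δ-turn {i} i<F = subst (λ x → δ.b i ≡ 1 ⇔ θS.T x) (trans (cong (suc i *_) h′≡) (height-of-turn i f)) (δS.rest-at-turn i<F)

      θ-odd-pattern : ∀ m → g ≡ suc (2 * m) → θ.Pattern (T 1) (T 2)
      θ-odd-pattern = θ.odd-pattern T 2<f 2<g coprime mirror mirror′ θ-turn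
      θ-even-pattern : ∀ m → g ≡ 2 * m → θ.Pattern (T 2) (T 2)
      θ-even-pattern = θ.even-pattern T 2<f 2<g coprime mirror mirror′ θ-turn
      δ-odd-pattern : ∀ m → f ≡ suc (2 * m) → δ.Pattern (T 1) (T 2)
      δ-odd-pattern = δ.odd-pattern T 2<g 2<f (Coprimality.sym coprime) mirror′ mirror δ-turn
      δ-even-pattern : ∀ m → f ≡ 2 * m → δ.Pattern (T 2) (T 2)
      δ-even-pattern = δ.even-pattern T 2<g 2<f (Coprimality.sym coprime) mirror′ mirror δ-turn

      1<F : 1 < θ.F
      1<F = s≤s⁻¹ 2<f
      1<G : 1 < δ.F
      1<G = s≤s⁻¹ 2<g
      0<F : 0 < θ.F
      0<F = <⇒≤ 1<F
      0<G : 0 < δ.F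
      0<G = <⇒≤ 1<G

      θ-odd : ∀ {m} → f ≡ suc (2 * m) → IsOdd θ
      θ-odd {m} f≡ = odd-∤ {j = m} (trans θ.freq≡ f≡)
      θ-even : ∀ {m} → f ≡ 2 * m → IsEven θ
      θ-even {m} f≡ = even-∣ {j = m} (trans θ.freq≡ f≡)
      δ-odd : ∀ {m} → g ≡ suc (2 * m) → IsOdd δ
      δ-odd {m} g≡ = odd-∤ {j = m} (trans δ.freq≡ g≡)
      δ-even : ∀ {m} → g ≡ 2 * m → IsEven δ
      δ-even {m} g≡ = even-∣ {j = m} (trans δ.freq≡ g≡)

    classification : Classification θ δ
    classification = go (even⊎odd f) (even⊎odd g)
      where
      go : (∃ λ i → f ≡ 2 * i) ⊎ (∃ λ i → f ≡ suc (2 * i)) → (∃ λ j → g ≡ 2 * j) ⊎ (∃ λ j → g ≡ suc (2 * j)) →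
           Classification θ δ
      go (inj₁ (i , f≡)) (inj₁ (j , g≡)) = contradiction (coprime {2} (even-∣ {j = i} f≡ , even-∣ {j = j} g≡)) λ ()
      -- Each pattern depends on the parity of the other frequency: θ alternates as `g` is odd, δ is
      -- uniform as `f` is even.
      go (inj₁ (i , f≡)) (inj₂ (j , g≡)) = decide (θ.decide-odd P 0<F) (θ.decide-even P 1<F)
        where
        P = θ-odd-pattern j g≡
        Q = δ-even-pattern i f≡
        decide : Dec (T 1) → Dec (T 2) → Classification θ δ
        decide (no ¬t₁) (no ¬t₂) = inj₁ (θ.neither P ¬t₁ ¬t₂ , δ.neither Q ¬t₂ ¬t₂)
        decide (yes t₁) (no ¬t₂) = inj₂ (inj₁ (inj₁ (θ-even {i} f≡ , θ.on-top P 0<F t₁ ¬t₂ , δ-odd {j} g≡ , δ.neither Q ¬t₂ ¬t₂)))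
        decide (no ¬t₁) (yes t₂) = inj₂ (inj₂ (inj₂ (inj₂ (inj₁ (inj₁ (θ-even {i} f≡ , θ.on-bottom P 1<F ¬t₁ t₂ , δ-odd {j} g≡ , δ.everywhere Q 0<G t₂ t₂))))))
        decide (yes t₁) (yes t₂) = inj₂ (inj₂ (inj₂ (inj₂ (inj₂ (θ.everywhere P 0<F t₁ t₂ , δ.everywhere Q 0<G t₂ t₂)))))
      -- Now θ is the uniform one and tells only about `T 2`, so δ has to decide `T 1`.
      go (inj₂ (i , f≡)) (inj₁ (j , g≡)) = decide (δ.decide-odd Q 0<G) (δ.decide-even Q 1<G)
        where
        P = θ-even-pattern j g≡
        Q = δ-odd-pattern i f≡
        decide : Dec (T 1) → Dec (T 2) → Classification θ δ
        decide (no ¬t₁) (no ¬t₂) = inj₁ (θ.neither P ¬t₂ ¬t₂ , δ.neither Q ¬t₁ ¬t₂)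
        decide (yes t₁) (no ¬t₂) = inj₂ (inj₁ (inj₂ (δ-even {j} g≡ , δ.on-top Q 0<G t₁ ¬t₂ , θ-odd {i} f≡ , θ.neither P ¬t₂ ¬t₂)))
        decide (no ¬t₁) (yes t₂) = inj₂ (inj₂ (inj₂ (inj₂ (inj₁ (inj₂ (δ-even {j} g≡ , δ.on-bottom Q 1<G ¬t₁ t₂ , θ-odd {i} f≡ , θ.everywhere P 0<F t₂ t₂))))))
        decide (yes t₁) (yes t₂) = inj₂ (inj₂ (inj₂ (inj₂ (inj₂ (θ.everywhere P 0<F t₂ t₂ , δ.everywhere Q 0<G t₁ t₂)))))
      go (inj₂ (i , f≡)) (inj₂ (j , g≡)) = decide (θ.decide-odd P 0<F) (θ.decide-even P 1<F)
        where
        P = θ-odd-pattern j g≡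
        Q = δ-odd-pattern i f≡
        decide : Dec (T 1) → Dec (T 2) → Classification θ δ
        decide (no ¬t₁) (no ¬t₂) = inj₁ (θ.neither P ¬t₁ ¬t₂ , δ.neither Q ¬t₁ ¬t₂)
        decide (yes t₁) (no ¬t₂) = inj₂ (inj₂ (inj₁ (θ-odd {i} f≡ , θ.on-top P 0<F t₁ ¬t₂ , δ-odd {j} g≡ , δ.on-top Q 0<G t₁ ¬t₂)))
        decide (no ¬t₁) (yes t₂) = inj₂ (inj₂ (inj₂ (inj₁ (inj₂ (θ-odd {i} f≡ , δ-odd {j} g≡) , θ.on-bottom P 1<F ¬t₁ t₂ , δ.on-bottom Q 1<G ¬t₁ t₂))))
        decide (yes t₁) (yes t₂) = inj₂ (inj₂ (inj₂ (inj₂ (inj₂ (θ.everywhere P 0<F t₁ t₂ , δ.everywhere Q 0<G t₁ t₂)))))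

-- Decidability makes the conclusion stable, which removes the double negation under which edges are
-- decided.
classification? : ∀ {n} (θ δ : Congruence n) → Dec (Classification θ δ)
classification? θ δ =
  (noRests? θ ×-dec noRests? δ)
  ⊎-dec ((isEven? θ ×-dec onTop? θ ×-dec ¬? (isEven? δ) ×-dec noRests? δ)
     ⊎-dec (isEven? δ ×-dec onTop? δ ×-dec ¬? (isEven? θ) ×-dec noRests? θ))
  ⊎-dec (¬? (isEven? θ) ×-dec onTop? θ ×-dec ¬? (isEven? δ) ×-dec onTop? δ)
  ⊎-dec (((isEven? θ ×-dec isEven? δ) ⊎-dec (¬? (isEven? θ) ×-dec ¬? (isEven? δ)))
     ×-dec onBottom? θ ×-dec onBottom? δ)
  ⊎-dec ((isEven? θ ×-dec onBottom? θ ×-dec ¬? (isEven? δ) ×-dec everywhere? δ)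
     ⊎-dec (isEven? δ ×-dec onBottom? δ ×-dec ¬? (isEven? θ) ×-dec everywhere? θ))
  ⊎-dec (everywhere? θ ×-dec everywhere? δ)
  where
  module _ {n} (θ : Congruence n) where
    isEven? : Dec (IsEven θ)
    isEven? = 2 ∣? freq θ

    noRests? : Dec (NoRests θ)
    noRests? = ≡-dec _≟_ (rests θ) []

    restsBy? : ∀ g → Dec (RestsBy θ g)
    restsBy? g = (1 ≤? mOf θ) ×-dec ≡-dec _≟_ (rests θ) (map (λ i → g (suc i)) (upTo (mOf θ)))

    onTop? : Dec (RestsOnTop θ)
    onTop? = restsBy? (λ i → (2 * kOf θ + 1) * i ∸ kOf θ ∸ 1)

    onBottom? : Dec (RestsOnBottom θ)
    onBottom? = restsBy? (λ i → (2 * kOf θ + 1) * i ∸ 1)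

    everywhere? : Dec (RestsEverywhere θ)
    everywhere? = restsBy? (λ i → (kOf θ + 1) * i ∸ 1)

theorem5p2 : (n : ℕ) → 1 ≤ n → (θ δ : Congruence n) →
    2 ≤ numClasses θ → 2 ≤ numClasses δ →
    kOf θ ≤ kOf δ →
    ¬ JoinIsFull θ δ →
    (∀ e → e ≤ n → ((Extreme θ e × Extreme δ e) → (e ≡ 0 ⊎ e ≡ n))
    × ((e ≡ 0 ⊎ e ≡ n) → (Extreme θ e × Extreme δ e))) →
    (freq δ ≡ 1)
    ⊎ (freq δ ≡ 2 × Mirrored θ)
    ⊎ (3 ≤ freq δ ×
    ((NoRests θ × NoRests δ)
    ⊎ ((IsEven θ × RestsOnTop θ × IsOdd δ × NoRests δ)
    ⊎ (IsEven δ × RestsOnTop δ × IsOdd θ × NoRests θ))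
    ⊎ (IsOdd θ × RestsOnTop θ × IsOdd δ × RestsOnTop δ)
    ⊎ (((IsEven θ × IsEven δ) ⊎ (IsOdd θ × IsOdd δ))
    × RestsOnBottom θ × RestsOnBottom δ)
    ⊎ ((IsEven θ × RestsOnBottom θ × IsOdd δ × RestsEverywhere δ)
    ⊎ (IsEven δ × RestsOnBottom δ × IsOdd θ × RestsEverywhere θ))
    ⊎ (RestsEverywhere θ × RestsEverywhere δ)))
theorem5p2 n _ θ δ 2≤θ 2≤δ k≤l notFull extremes = by-frequency δ.F refl
  where
  module δ = Profile δ 2≤δ
  module Main = Theorem θ δ 2≤θ 2≤δ k≤l notFull (λ e e≤n eθ eδ → proj₁ (extremes e e≤n) (eθ , eδ))

  with-edges : ∀ {A : Set} → Dec A → ((∀ r → Dec (Joins.JoinEdge θ δ r)) → A) → A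
  with-edges A? proof = decidable-stable A? λ ¬a → Joins.¬¬-edge? θ δ λ edge? → ¬a (proof edge?)

  reflected : δ.F ≡ 1 → ∀ {r} → r ∈ rests θ → n ∸ r ∸ 1 ∈ rests θ
  reflected G≡1 {r} r∈ = with-edges (n ∸ r ∸ 1 ∈? rests θ) λ edge? → Main.mirrored edge? (cong suc G≡1) r∈

  -- Yields the converse direction of `Mirrored` from `reflected`.
  involution : ∀ {r} → r < n → n ∸ (n ∸ r ∸ 1) ∸ 1 ≡ r
  involution {r} r<n = begin
    n ∸ (n ∸ r ∸ 1) ∸ 1     ≡⟨ cong (λ x → n ∸ x ∸ 1) (trans (∸-+-assoc n r 1) (cong (n ∸_) (+-comm r 1))) ⟩
    n ∸ (n ∸ suc r) ∸ 1     ≡⟨ cong (_∸ 1) (m∸[m∸n]≡n r<n) ⟩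
    r                       ∎
    where open ≡-Reasoning

  -- `δ.F` counts the turns of δ, one less than its frequency.
  by-frequency : ∀ G → δ.F ≡ G → freq δ ≡ 1 ⊎ (freq δ ≡ 2 × Mirrored θ) ⊎ (3 ≤ freq δ × Classification θ δ)
  by-frequency zero G≡ = inj₁ (trans δ.freq≡ (cong suc G≡))
  by-frequency (suc zero) G≡ = inj₂ (inj₁ (trans δ.freq≡ (cong suc G≡) , λ r r<n →
    reflected G≡ , λ r′∈ → subst (_∈ rests θ) (involution r<n) (reflected G≡ r′∈)))
  by-frequency (suc (suc G)) G≡ = inj₂ (inj₂ (subst (3 ≤_) (sym δ.freq≡) 2<g , with-edges (classification? θ δ)
    λ edge? → Main.classification edge? 2<g))
    where
    2<g : 3 ≤ δ.f
    2<g = subst (λ m → 3 ≤ suc m) (sym G≡) (s≤s (s≤s (s≤s z≤n)))
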